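{- Let $p$ be a prime, $d\in\mathbb{N}$ and $\ell=\ell_p(d)=\lceil\log_p(d+1)\rceil$. If $n\ge 4p^\ell-1$, then for every $E\subseteq[d,n-d]$, over $\mathbb{F}_p$ we have $\operatorname{Z\text{ - }cl}_{n,d}(E)=\operatorname{Sym\text{ - }cl}_{n,d}(E)$.
   Context: For integers $a\le b$, $[a,b]$ denotes the set of integers between $a$ and $b$. Work over $\mathbb{F}_p$ with $\{0,1\}^n\subseteq\mathbb{F}_p^n$; $|x|$ is the Hamming weight of $x\in\{0,1\}^n$, and for $E\subseteq[0,n]$, $\underline{E}=\{x\in\{0,1\}^n:|x|\in E\}$. The degree-$d$ Zariski closure $\operatorname{Z\text{ - }cl}_{n,d}(\underline{E})$ is the set of $y\in\{0,1\}^n$ at which every polynomial in $\mathbb{F}_p[X_1,\dots,X_n]$ of degree at most $d$ vanishing on $\underline{E}$ also vanishes. The degree-$d$ symmetric closure $\operatorname{Sym\text{ - }cl}_{n,d}(\underline{E})$ is the set of $y\in\{0,1\}^n$ at which every symmetric polynomial in $\mathbb{F}_p[X_1,\dots,X_n]$ (invariant under all permutations of the variables) of degree at most $d$ vanishing on $\underline{E}$ also vanishes. Both sets are symmetric, and are identified with the corresponding sets of Hamming weights in $[0,n]$, denoted $\operatorname{Z\text{ - }cl}_{n,d}(E)$ and $\operatorname{Sym\text{ - }cl}_{n,d}(E)$. -}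

module Defs where

open import Data.Nat.Base using (ℕ; zero; suc; _+_; _*_; _^_; _≤_; _<_; ∣_-_∣)
open import Data.Nat.Divisibility using (_∣_)
open import Data.Nat.Properties using (_≟_)
open import Data.Bool.Base using (Bool; true; false; if_then_else_)
open import Data.Product using (_×_; _,_; proj₁; proj₂)
open import Data.List.Base using (List; []; _∷_)
open import Data.List.Relation.Unary.All using (All)
open import Data.Vec.Base using (Vec; []; _∷_; lookup; tabulate; countᵇ)
open import Data.Vec.Properties using (≡-dec)
open import Data.Fin.Permutation using (Permutation′; _⟨$⟩ʳ_)
open import Relation.Nullary using (does)
open import Function using (id)

_≡_[mod_] : ℕ → ℕ → ℕ → Set
a ≡ b [mod p ] = p ∣ ∣ a - b ∣

Monomial : ℕ → Set
Monomial n = Vec ℕ n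

-- A polynomial over F_p in n variables, represented as a finite formal sum
-- of terms  c · X^m  (coefficient c ∈ ℕ, read modulo p).
Poly : ℕ → Set
Poly n = List (ℕ × Monomial n)

totalDegree : ∀ {n} → Monomial n → ℕ
totalDegree [] = 0
totalDegree (e ∷ m) = e + totalDegree m

-- Degree at most d: every monomial occurring has total degree at most d.
-- (Every polynomial of degree ≤ d has such a representation.)
DegLe : ∀ {n} → ℕ → Poly n → Set
DegLe d P = All (λ t → totalDegree (proj₂ t) ≤ d) P

coeff : ∀ {n} → Poly n → Monomial n → ℕ
coeff [] m = 0
coeff ((c , m′) ∷ P) m = (if does (≡-dec _≟_ m′ m) then c else 0) + coeff P m

-- Permuting the variables: X_i ↦ X_{σ(i)} sends the exponent vector m
-- to the vector whose σ(i)-th entry is m_i; equivalently we compare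
-- coefficients of m and m ∘ σ.
permMon : ∀ {n} → Permutation′ n → Monomial n → Monomial n
permMon σ m = tabulate (λ i → lookup m (σ ⟨$⟩ʳ i))

Symmetric : ∀ {n} → ℕ → Poly n → Set
Symmetric {n} p P =
  (σ : Permutation′ n) (m : Monomial n) → coeff P (permMon σ m) ≡ coeff P m [mod p ]

bit : Bool → ℕ
bit true = 1
bit false = 0

evalMon : ∀ {n} → Vec Bool n → Monomial n → ℕ
evalMon [] [] = 1
evalMon (b ∷ x) (e ∷ m) = bit b ^ e * evalMon x m

eval : ∀ {n} → Poly n → Vec Bool n → ℕ
eval [] x = 0
eval ((c , m) ∷ P) x = c * evalMon x m + eval P x

VanishesAt : ∀ {n} → ℕ → Poly n → Vec Bool n → Set
VanishesAt p P x = p ∣ eval P x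

weight : ∀ {n} → Vec Bool n → ℕ
weight x = countᵇ id x

VanishesOn : ∀ {n} → ℕ → Poly n → (ℕ → Set) → Set
VanishesOn {n} p P E = (x : Vec Bool n) → E (weight x) → VanishesAt p P x

InZcl : (p n d : ℕ) → (ℕ → Set) → Vec Bool n → Set
InZcl p n d E y =
  (P : Poly n) → DegLe d P → VanishesOn p P E → VanishesAt p P y

InSymcl : (p n d : ℕ) → (ℕ → Set) → Vec Bool n → Set
InSymcl p n d E y =
  (P : Poly n) → DegLe d P → Symmetric p P → VanishesOn p P E → VanishesAt p P y

IsCeilLog : (p d ℓ : ℕ) → Set
IsCeilLog p d ℓ = (suc d ≤ p ^ ℓ) × ((k : ℕ) → k < ℓ → p ^ k < suc d)

{-# OPTIONS --safe #-}

-- Put q = p^ℓ > d. Let P have degree ≤ d and vanish on the slices in E.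
--
-- Periodicity: on a cube of dimension q + d the value of P at the top (bottom) point is
-- congruent to its sum over slice d (slice q), by Lucas-type congruences. Hence vanishing on a slice
-- k ∈ [d, n − d] is inherited by every slice of weight ≡ k mod q.
--
-- Symmetrization: on a cube of dimension q − 1 every slice has cardinality ±1 mod p, so averaging P
-- over the slices of such a subcube with q further ones gives a symmetric function of degree ≤ d,
-- which vanishes on E and therefore on the weight, ≡ r mod q, of a point in the symmetric closure.
--
-- It remains to see that P is constant on slice q + r. The difference of P at points that differ by
-- exchanging two coordinates is a polynomial of degree ≤ d − 1 in the other n − 2 coordinates, and
-- it satisfies the same hypotheses, so it vanishes on this slice by induction on the degree.

module Submission where

open import Defs
open import Data.Bool.Base using (Bool; true; false; if_then_else_)
open import Data.Empty using (⊥-elim)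
open import Data.Fin.Base using (Fin; zero; suc)
open import Data.Fin.Permutation using (Permutation′; _⟨$⟩ʳ_; _⟨$⟩ˡ_; inverseʳ)
open import Data.Fin.Properties using (all?)
open import Data.Integer.Base as ℤ using (ℤ; +_; 0ℤ; 1ℤ)
open import Data.Integer.DivMod using (_%ℕ_; _/ℕ_; a≡a%ℕn+[a/ℕn]*n)
open import Data.List.Base using ([]; _∷_; _++_; map)
open import Data.List.Relation.Unary.All as All using (All; []; _∷_)
open import Data.List.Relation.Unary.All.Properties using (++⁺; map⁺)
open import Data.Nat.Base using (ℕ; zero; suc; NonZero; _≤_; _<_; z≤n; s≤s; _∸_; _+_; _*_; _^_; _/_; _%_; _≡ᵇ_)
open import Data.Nat.Combinatorics using (_C_; nCk≡nC[n∸k]; nCn≡1; nCk+nC[k+1]≡[n+1]C[k+1]; k>n⇒nCk≡0)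
open import Data.Nat.Primality using (Prime; euclidsLemma; prime⇒nonZero)
open import Data.Product using (_×_; _,_; proj₁; proj₂; ∃; Σ)
open import Data.Sum.Base using (inj₁; inj₂)
open import Data.Unit.Base using (⊤; tt)
open import Data.Vec.Base using (Vec; []; _∷_; replicate; lookup; tabulate)
open import Data.Vec.Properties using (count≤n; lookup∘tabulate; ≡-dec)
open import Function.Base using (_∘_)
open import Function.Bundles using (_⇔_; mk⇔)
open import Relation.Binary.Bundles using (Setoid)
open import Relation.Binary.PropositionalEquality using (_≡_; refl; sym; trans; cong; cong₂; subst; module ≡-Reasoning)
open import Relation.Nullary using (¬_; yes; no; does)
import Data.Integer.Divisibility.Signed as ℤ∣
import Data.Integer.Properties as ℤ
import Data.Integer.Tactic.RingSolver as ℤSolver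
import Data.Nat.Divisibility as ℕ∣
import Data.Nat.DivMod as ℕ
import Data.Nat.Properties as ℕ
import Data.Nat.Tactic.RingSolver as ℕSolver
import Relation.Binary.Reasoning.Setoid as SetoidReasoning
open import Algebra.Properties.CommutativeMonoid.Sum ℕ.+-0-commutativeMonoid using (sum; sum-permute)

private
  variable
    m n : ℕ

-- Binomial coefficients

nC0≡1 : ∀ n → n C 0 ≡ 1
nC0≡1 n = trans (nCk≡nC[n∸k] {0} {n} z≤n) (nCn≡1 n)

pascal : ∀ n k → suc n C suc k ≡ n C k + n C suc k
pascal n k = sym (nCk+nC[k+1]≡[n+1]C[k+1] n k)

-- Proved by Pascal's rule, without division. It shows that `suc n` divides
-- `suc k * (suc n C suc k)`, the starting point for the divisibility of binomials by `p`.
absorption : ∀ n k → suc k * (suc n C suc k) ≡ suc n * (n C k)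
absorption zero zero = refl
absorption zero (suc k) = begin
  suc (suc k) * (1 C suc (suc k)) ≡⟨ cong (suc (suc k) *_) (k>n⇒nCk≡0 {1} {suc (suc k)} (s≤s (s≤s z≤n))) ⟩
  suc (suc k) * 0                 ≡⟨ ℕ.*-zeroʳ (suc (suc k)) ⟩
  0                               ≡⟨ cong (1 *_) (k>n⇒nCk≡0 {0} {suc k} (s≤s z≤n)) ⟨
  1 * (0 C suc k)                 ∎
  where open ≡-Reasoning
absorption (suc n) zero = begin
  1 * (suc (suc n) C 1)              ≡⟨ cong (1 *_) (pascal (suc n) 0) ⟩
  1 * ((suc n C 0) + (suc n C 1))    ≡⟨ ℕ.*-identityˡ _ ⟩
  (suc n C 0) + (suc n C 1)          ≡⟨ cong₂ _+_ (nC0≡1 (suc n)) (trans (sym (ℕ.*-identityˡ _)) (absorption n 0)) ⟩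
  1 + suc n * (n C 0)                ≡⟨ cong (λ c → 1 + suc n * c) (nC0≡1 n) ⟩
  1 + suc n * 1                      ≡⟨ cong (λ c → suc (suc n) * c) (nC0≡1 (suc n)) ⟨
  suc (suc n) * (suc n C 0)          ∎
  where open ≡-Reasoning
absorption (suc n) (suc k) = begin
  suc (suc k) * (suc (suc n) C suc (suc k))
    ≡⟨ cong (suc (suc k) *_) (pascal (suc n) (suc k)) ⟩
  suc (suc k) * (c + suc n C suc (suc k))
    ≡⟨ ℕ.*-distribˡ-+ (suc (suc k)) c _ ⟩
  suc (suc k) * c + suc (suc k) * (suc n C suc (suc k))
    ≡⟨ cong (λ v → suc (suc k) * c + v) (absorption n (suc k)) ⟩
  (c + suc k * c) + suc n * (n C suc k)
    ≡⟨ cong (λ v → (c + v) + suc n * (n C suc k)) (absorption n k) ⟩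
  (c + suc n * (n C k)) + suc n * (n C suc k)
    ≡⟨ regroup c (suc n) (n C k) (n C suc k) ⟩
  c + suc n * (n C k + n C suc k)
    ≡⟨ cong (λ v → c + suc n * v) (pascal n k) ⟨
  suc (suc n) * c ∎
  where
  open ≡-Reasoning
  c = suc n C suc k
  regroup : ∀ c N a b → (c + N * a) + N * b ≡ c + N * (a + b)
  regroup = ℕSolver.solve-∀

-- Euclid's lemma strips one factor `p` from `i` at a time, as `c` can absorb none of them.
primePower∣*⇒∣ : ∀ {p} → Prime p → ∀ ℓ i {c} → ¬ (p ℕ∣.∣ c) → p ^ ℓ ℕ∣.∣ i * c → p ^ ℓ ℕ∣.∣ i
primePower∣*⇒∣ pr zero i p∤c _ = ℕ∣.1∣ i
primePower∣*⇒∣ {p} pr (suc ℓ) i {c} p∤c pᵉ∣ic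
  with euclidsLemma i c pr (ℕ∣.∣-trans (ℕ∣.m∣m*n (p ^ ℓ)) pᵉ∣ic)
... | inj₂ p∣c = ⊥-elim (p∤c p∣c)
... | inj₁ (ℕ∣.divides j refl) = subst (p * p ^ ℓ ℕ∣.∣_) (ℕ.*-comm p j) (ℕ∣.*-monoʳ-∣ p
        (primePower∣*⇒∣ pr ℓ j p∤c (ℕ∣.*-cancelˡ-∣ p {{nz}} (subst (p * p ^ ℓ ℕ∣.∣_) (regroup j p c) pᵉ∣ic))))
  where
  nz : NonZero p
  nz = prime⇒nonZero pr
  regroup : ∀ j p c → (j * p) * c ≡ p * (j * c)
  regroup = ℕSolver.solve-∀

-- By absorption `p ^ ℓ` divides `suc i` times the binomial. If `p` did not divide the binomial, all
-- of `p ^ ℓ` would divide the smaller positive number `suc i`.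
prime∣primePowerCk : ∀ {p} → Prime p → ∀ ℓ i → suc i < p ^ ℓ → p ℕ∣.∣ p ^ ℓ C suc i
prime∣primePowerCk {p} pr ℓ i i<q with p ^ ℓ in eq
... | suc N with p ℕ∣.∣? (suc N C suc i)
...   | yes p∣c = p∣c
...   | no p∤c = ⊥-elim (ℕ.<⇒≱ i<q (ℕ∣.∣⇒≤ (subst (ℕ∣._∣ suc i) eq
          (primePower∣*⇒∣ pr ℓ (suc i) p∤c (subst (ℕ∣._∣ suc i * (suc N C suc i)) (sym eq)
            (subst (suc N ℕ∣.∣_) (sym (absorption N i)) (ℕ∣.m∣m*n (N C i))))))))

-- Functions on the cube

∑ : ℕ → (ℕ → ℤ) → ℤ
∑ zero    h = 0ℤ
∑ (suc e) h = h 0 ℤ.+ ∑ e (h ∘ suc)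

∑-cong : ∀ e {g h} → (∀ j → g j ≡ h j) → ∑ e g ≡ ∑ e h
∑-cong zero    eq = refl
∑-cong (suc e) eq = cong₂ ℤ._+_ (eq 0) (∑-cong e (eq ∘ suc))

∑-zero : ∀ e {h} → (∀ j → h j ≡ 0ℤ) → ∑ e h ≡ 0ℤ
∑-zero zero    eq = refl
∑-zero (suc e) eq = cong₂ ℤ._+_ (eq 0) (∑-zero e (eq ∘ suc))

∑-+ : ∀ e g h → ∑ e (λ j → g j ℤ.+ h j) ≡ ∑ e g ℤ.+ ∑ e h
∑-+ zero    g h = refl
∑-+ (suc e) g h = trans (cong (λ s → (g 0 ℤ.+ h 0) ℤ.+ s) (∑-+ e (g ∘ suc) (h ∘ suc)))
                        (regroup (g 0) (h 0) (∑ e (g ∘ suc)) (∑ e (h ∘ suc)))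
  where
  regroup : ∀ a b c d → (a ℤ.+ b) ℤ.+ (c ℤ.+ d) ≡ (a ℤ.+ c) ℤ.+ (b ℤ.+ d)
  regroup = ℤSolver.solve-∀

∑-*ˡ : ∀ e a h → ∑ e (λ j → a ℤ.* h j) ≡ a ℤ.* ∑ e h
∑-*ˡ zero    a h = sym (ℤ.*-zeroʳ a)
∑-*ˡ (suc e) a h = trans (cong (λ s → a ℤ.* h 0 ℤ.+ s) (∑-*ˡ e a (h ∘ suc))) (sym (ℤ.*-distribˡ-+ a _ _))

CubeFun : ℕ → Set
CubeFun n = Vec Bool n → ℤ

-- On the cube f = f₀ + x₁ · `Δ f`, so this is the coefficient of the first variable in the
-- multilinear form of `f`.
Δ : CubeFun (suc n) → CubeFun n
Δ f x = f (true ∷ x) ℤ.- f (false ∷ x)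

-- The bound is strict so that e = 0 can stand for the zero function.
Degree< : ℕ → CubeFun n → Set
Degree< zero f = ∀ x → f x ≡ 0ℤ
Degree< {zero}  (suc e) f = ⊤
Degree< {suc n} (suc e) f = Degree< (suc e) (f ∘ (false ∷_)) × Degree< e (Δ f)

Degree<-zero : ∀ e {f : CubeFun n} → (∀ x → f x ≡ 0ℤ) → Degree< e f
Degree<-zero zero f≡0 = f≡0
Degree<-zero {zero}  (suc e) f≡0 = tt
Degree<-zero {suc n} (suc e) f≡0 =
  Degree<-zero (suc e) (f≡0 ∘ (false ∷_)) ,
  Degree<-zero e (λ x → cong₂ ℤ._-_ (f≡0 (true ∷ x)) (f≡0 (false ∷ x)))

Degree<-cong : ∀ e {f g : CubeFun n} → (∀ x → f x ≡ g x) → Degree< e f → Degree< e g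
Degree<-cong zero f≡g df x = trans (sym (f≡g x)) (df x)
Degree<-cong {zero}  (suc e) f≡g df = tt
Degree<-cong {suc n} (suc e) f≡g (df₀ , dΔ) =
  Degree<-cong (suc e) (f≡g ∘ (false ∷_)) df₀ ,
  Degree<-cong e (λ x → cong₂ ℤ._-_ (f≡g (true ∷ x)) (f≡g (false ∷ x))) dΔ

Degree<-mono : ∀ {e e′} {f : CubeFun n} → e ≤ e′ → Degree< e f → Degree< e′ f
Degree<-mono z≤n df = Degree<-zero _ df
Degree<-mono {zero}  (s≤s le) df         = tt
Degree<-mono {suc n} (s≤s le) (df₀ , dΔ) = Degree<-mono (s≤s le) df₀ , Degree<-mono le dΔ

Degree<-comb : ∀ e a b {f g : CubeFun n} → Degree< e f → Degree< e g →
               Degree< e (λ x → a ℤ.* f x ℤ.+ b ℤ.* g x)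
Degree<-comb zero a b df dg x =
  trans (cong₂ (λ u v → a ℤ.* u ℤ.+ b ℤ.* v) (df x) (dg x)) (cong₂ ℤ._+_ (ℤ.*-zeroʳ a) (ℤ.*-zeroʳ b))
Degree<-comb {zero}  (suc e) a b df dg = tt
Degree<-comb {suc n} (suc e) a b {f} {g} (df₀ , dΔf) (dg₀ , dΔg) =
  Degree<-comb (suc e) a b df₀ dg₀ ,
  Degree<-cong e (λ x → regroup a b (f (true ∷ x)) (f (false ∷ x)) (g (true ∷ x)) (g (false ∷ x)))
    (Degree<-comb e a b dΔf dΔg)
  where
  regroup : ∀ a b f₁ f₀ g₁ g₀ → a ℤ.* (f₁ ℤ.- f₀) ℤ.+ b ℤ.* (g₁ ℤ.- g₀) ≡
            (a ℤ.* f₁ ℤ.+ b ℤ.* g₁) ℤ.- (a ℤ.* f₀ ℤ.+ b ℤ.* g₀)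
  regroup = ℤSolver.solve-∀

-- The restriction to first coordinate 1 is f₀ + `Δ f`, and both summands satisfy the bound.
Degree<-true : ∀ e {f : CubeFun (suc n)} → Degree< e f → Degree< e (f ∘ (true ∷_))
Degree<-true zero df = df ∘ (true ∷_)
Degree<-true (suc e) {f} (df₀ , dΔ) =
  Degree<-cong (suc e) (λ x → regroup (f (true ∷ x)) (f (false ∷ x)))
    (Degree<-comb (suc e) 1ℤ 1ℤ df₀ (Degree<-mono (ℕ.n≤1+n e) dΔ))
  where
  regroup : ∀ a b → 1ℤ ℤ.* b ℤ.+ 1ℤ ℤ.* (a ℤ.- b) ≡ a
  regroup = ℤSolver.solve-∀

Degree<-false : ∀ e {f : CubeFun (suc n)} → Degree< e f → Degree< e (f ∘ (false ∷_))
Degree<-false zero    df        = df ∘ (false ∷_)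
Degree<-false (suc e) (df₀ , _) = df₀

-- Subcubes with free and fixed coordinates

data Subcube : ℕ → ℕ → Set where
  []    : Subcube 0 0
  free  : Subcube m n → Subcube (suc m) (suc n)
  fixed : Bool → Subcube m n → Subcube m (suc n)

point : Subcube m n → Vec Bool m → Vec Bool n
point []          []      = []
point (free s)    (b ∷ z) = b ∷ point s z
point (fixed b s) z       = b ∷ point s z

fixedOnes : Subcube m n → ℕ
fixedOnes []          = 0
fixedOnes (free s)    = fixedOnes s
fixedOnes (fixed b s) = bit b + fixedOnes s

weight-∷ : ∀ b (x : Vec Bool n) → weight (b ∷ x) ≡ bit b + weight x
weight-∷ true  x = refl
weight-∷ false x = refl

weight-point : (s : Subcube m n) (z : Vec Bool m) → weight (point s z) ≡ fixedOnes s + weight z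
weight-point []       [] = refl
weight-point (free s) (true  ∷ z) = trans (cong suc (weight-point s z)) (sym (ℕ.+-suc _ _))
weight-point (free s) (false ∷ z) = weight-point s z
weight-point (fixed b s) z = trans (weight-∷ b (point s z))
  (trans (cong (λ v → bit b + v) (weight-point s z)) (sym (ℕ.+-assoc (bit b) _ _)))

Degree<-point : ∀ e (s : Subcube m n) {f : CubeFun n} → Degree< e f → Degree< e (f ∘ point s)
Degree<-point zero s df = df ∘ point s
Degree<-point (suc e) []              df         = df
Degree<-point (suc e) (free s)        (df₀ , dΔ) = Degree<-point (suc e) s df₀ , Degree<-point e s dΔ
Degree<-point (suc e) (fixed false s) (df₀ , dΔ) = Degree<-point (suc e) s df₀
Degree<-point (suc e) (fixed true s) {f} df      = Degree<-point (suc e) s (Degree<-true (suc e) {f} df)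

allTrue allFalse : ∀ m → Vec Bool m
allTrue  m = replicate m true
allFalse m = replicate m false

weight-allTrue : ∀ m → weight (allTrue m) ≡ m
weight-allTrue zero    = refl
weight-allTrue (suc m) = cong suc (weight-allTrue m)

weight-allFalse : ∀ m → weight (allFalse m) ≡ 0
weight-allFalse zero    = refl
weight-allFalse (suc m) = weight-allFalse m

-- The first `m` ones of `y` are freed, which makes `y` the top point.
subcubeBelow : ∀ m (y : Vec Bool n) → m ≤ weight y → Σ (Subcube m n) λ s → point s (allTrue m) ≡ y
subcubeBelow zero    [] _ = [] , refl
subcubeBelow zero    (b ∷ y) _ = let s , eq = subcubeBelow zero y z≤n in fixed b s , cong (b ∷_) eq
subcubeBelow (suc m) (true  ∷ y) (s≤s le) = let s , eq = subcubeBelow m y le in free s , cong (true ∷_) eq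
subcubeBelow (suc m) (false ∷ y) le = let s , eq = subcubeBelow (suc m) y le in fixed false s , cong (false ∷_) eq

-- The first `m` zeros of `y` are freed, which makes `y` the bottom point; the hypothesis says that
-- there are enough zeros.
subcubeAbove : ∀ m (y : Vec Bool n) → m + weight y ≤ n → Σ (Subcube m n) λ s → point s (allFalse m) ≡ y
subcubeAbove zero    [] _ = [] , refl
subcubeAbove zero    (true  ∷ y) (s≤s le) = let s , eq = subcubeAbove zero y le in fixed true s , cong (true ∷_) eq
subcubeAbove zero    (false ∷ y) le = let s , eq = subcubeAbove zero y (count≤n _ y) in fixed false s , cong (false ∷_) eq
subcubeAbove {suc n} (suc m) (true  ∷ y) le =
  let s , eq = subcubeAbove (suc m) y (ℕ.≤-pred (subst (_≤ suc n) (cong suc (ℕ.+-suc m (weight y))) le))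
  in fixed true s , cong (true ∷_) eq
subcubeAbove (suc m) (false ∷ y) (s≤s le) = let s , eq = subcubeAbove m y le in free s , cong (false ∷_) eq

subcubeWith : ∀ n m b → m + b ≤ n → Σ (Subcube m n) λ s → fixedOnes s ≡ b
subcubeWith zero    zero    zero    _ = [] , refl
subcubeWith (suc n) (suc m) b (s≤s le) = let s , eq = subcubeWith n m b le in free s , eq
subcubeWith (suc n) zero zero _ = let s , eq = subcubeWith n zero zero z≤n in fixed false s , eq
subcubeWith (suc n) zero (suc b) (s≤s le) = let s , eq = subcubeWith n zero b le in fixed true s , cong suc eq

-- Sums over slices

sliceSum : ℕ → CubeFun n → ℤ
sliceSum {zero}  zero    f = f []
sliceSum {zero}  (suc k) f = 0ℤ
sliceSum {suc n} zero    f = sliceSum zero (f ∘ (false ∷_))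
sliceSum {suc n} (suc k) f = sliceSum (suc k) (f ∘ (false ∷_)) ℤ.+ sliceSum k (f ∘ (true ∷_))

sliceSum-zero : ∀ k {f : CubeFun n} → (∀ x → f x ≡ 0ℤ) → sliceSum k f ≡ 0ℤ
sliceSum-zero {zero}  zero    f≡0 = f≡0 []
sliceSum-zero {zero}  (suc k) f≡0 = refl
sliceSum-zero {suc n} zero    f≡0 = sliceSum-zero {n} zero (f≡0 ∘ (false ∷_))
sliceSum-zero {suc n} (suc k) f≡0 =
  cong₂ ℤ._+_ (sliceSum-zero {n} (suc k) (f≡0 ∘ (false ∷_))) (sliceSum-zero {n} k (f≡0 ∘ (true ∷_)))

sliceSum-Δ : ∀ k (f g : CubeFun n) → sliceSum k f ≡ sliceSum k g ℤ.+ sliceSum k (λ x → f x ℤ.- g x)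
sliceSum-Δ {zero}  zero    f g = regroup (f []) (g [])
  where
  regroup : ∀ a b → a ≡ b ℤ.+ (a ℤ.- b)
  regroup = ℤSolver.solve-∀
sliceSum-Δ {zero}  (suc k) f g = refl
sliceSum-Δ {suc n} zero    f g = sliceSum-Δ {n} zero (f ∘ (false ∷_)) (g ∘ (false ∷_))
sliceSum-Δ {suc n} (suc k) f g =
  trans (cong₂ ℤ._+_ (sliceSum-Δ {n} (suc k) (f ∘ (false ∷_)) (g ∘ (false ∷_))) (sliceSum-Δ {n} k (f ∘ (true ∷_)) (g ∘ (true ∷_))))
        (regroup (sliceSum (suc k) (g ∘ (false ∷_))) _ (sliceSum k (g ∘ (true ∷_))) _)
  where
  regroup : ∀ a b c d → (a ℤ.+ b) ℤ.+ (c ℤ.+ d) ≡ (a ℤ.+ c) ℤ.+ (b ℤ.+ d)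
  regroup = ℤSolver.solve-∀

sliceSum-bottom : (f : CubeFun n) → sliceSum 0 f ≡ f (allFalse n)
sliceSum-bottom {zero}  f = refl
sliceSum-bottom {suc n} f = sliceSum-bottom (f ∘ (false ∷_))

sliceSum-above : ∀ k (f : CubeFun n) → n < k → sliceSum k f ≡ 0ℤ
sliceSum-above {zero}  (suc k) f _ = refl
sliceSum-above {suc n} (suc k) f (s≤s n<k) =
  cong₂ ℤ._+_ (sliceSum-above (suc k) (f ∘ (false ∷_)) (ℕ.m<n⇒m<1+n n<k)) (sliceSum-above k (f ∘ (true ∷_)) n<k)

sliceSum-top : (f : CubeFun n) → sliceSum n f ≡ f (allTrue n)
sliceSum-top {zero}  f = refl
sliceSum-top {suc n} f = trans
  (cong₂ ℤ._+_ (sliceSum-above (suc n) (f ∘ (false ∷_)) (ℕ.n<1+n n)) (sliceSum-top (f ∘ (true ∷_))))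
  (ℤ.+-identityˡ _)

sliceSum-const : ∀ n k v → sliceSum {n} k (λ _ → v) ≡ v ℤ.* + (n C k)
sliceSum-const zero    zero    v = sym (ℤ.*-identityʳ v)
sliceSum-const zero    (suc k) v = sym (trans (cong (λ c → v ℤ.* + c) (k>n⇒nCk≡0 {0} {suc k} (s≤s z≤n))) (ℤ.*-zeroʳ v))
sliceSum-const (suc n) zero    v = trans (sliceSum-const n zero v)
  (cong (λ c → v ℤ.* + c) (trans (nC0≡1 n) (sym (nC0≡1 (suc n)))))
sliceSum-const (suc n) (suc k) v = begin
  sliceSum {n} (suc k) (λ _ → v) ℤ.+ sliceSum {n} k (λ _ → v) ≡⟨ cong₂ ℤ._+_ (sliceSum-const n (suc k) v) (sliceSum-const n k v) ⟩
  v ℤ.* + (n C suc k) ℤ.+ v ℤ.* + (n C k)     ≡⟨ ℤ.*-distribˡ-+ v _ _ ⟨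
  v ℤ.* + (n C suc k + n C k)                 ≡⟨ cong (λ c → v ℤ.* + c) (trans (ℕ.+-comm (n C suc k) _) (sym (pascal n k))) ⟩
  v ℤ.* + (suc n C suc k)                     ∎
  where open ≡-Reasoning

-- The number of k-subsets of an m-set that contain j given elements.
supersets : ℕ → ℕ → ℕ → ℕ
supersets m       zero    k       = m C k
supersets zero    (suc j) k       = 0
supersets (suc m) (suc j) zero    = 0
supersets (suc m) (suc j) (suc k) = supersets m j k

supersets-zero : ∀ m j → supersets m (suc j) 0 ≡ 0
supersets-zero zero    j = refl
supersets-zero (suc m) j = refl

-- Pascal's rule for an element outside the `j` given ones. The bound excludes `j = suc m`, where
-- the left side can be 1 while the right side is 0.
supersets-pascal : ∀ m j k → j ≤ m → supersets (suc m) j (suc k) ≡ supersets m j k + supersets m j (suc k)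
supersets-pascal m       zero          k       _        = pascal m k
supersets-pascal (suc m) (suc zero)    zero    _        = trans (nC0≡1 (suc m)) (sym (nC0≡1 m))
supersets-pascal (suc m) (suc (suc j)) zero    _        = sym (supersets-zero m j)
supersets-pascal (suc m) (suc j)       (suc k) (s≤s le) = supersets-pascal m j k le

supersets-+ : ∀ j m k → supersets (j + m) j (j + k) ≡ m C k
supersets-+ zero    m k = refl
supersets-+ (suc j) m k = supersets-+ j m k

supersets-< : ∀ m j k → k < j → supersets m j k ≡ 0
supersets-< zero    (suc j) k       _         = refl
supersets-< (suc m) (suc j) zero    _         = refl
supersets-< (suc m) (suc j) (suc k) (s≤s k<j) = supersets-< m j k k<j

-- Here A j is the sum of the coefficients of the squarefree monomials of degree j in f.
sliceSum-formula : ∀ e (f : CubeFun m) → Degree< e f → Σ (ℕ → ℤ) λ A →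
  (∀ j → m < j → A j ≡ 0ℤ) × (∀ k → sliceSum k f ≡ ∑ e (λ j → A j ℤ.* + supersets m j k))
sliceSum-formula zero f df = (λ _ → 0ℤ) , (λ _ _ → refl) , λ k → sliceSum-zero k df
sliceSum-formula {zero} (suc e) f df = A , (λ { (suc j) _ → refl }) , formula
  where
  A : ℕ → ℤ
  A zero    = f []
  A (suc j) = 0ℤ
  formula : ∀ k → sliceSum k f ≡ ∑ (suc e) (λ j → A j ℤ.* + supersets zero j k)
  formula zero    = sym (trans (cong₂ ℤ._+_ (ℤ.*-identityʳ (f [])) (∑-zero e (λ _ → refl))) (ℤ.+-identityʳ (f [])))
  formula (suc k) = sym (cong₂ ℤ._+_
    (trans (cong (λ c → f [] ℤ.* + c) (k>n⇒nCk≡0 {0} {suc k} (s≤s z≤n))) (ℤ.*-zeroʳ (f [])))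
    (∑-zero e (λ _ → refl)))
sliceSum-formula {suc m} (suc e) f (df₀ , dΔ) = A , A-vanishes , formula
  where
  open ≡-Reasoning
  f₀ f₁ : CubeFun m
  f₀ = f ∘ (false ∷_)
  f₁ = f ∘ (true ∷_)
  ih₀ = sliceSum-formula (suc e) f₀ df₀
  ihΔ = sliceSum-formula e (Δ f) dΔ
  A₀ A′ : ℕ → ℤ
  A₀ = proj₁ ih₀
  A′ = proj₁ ihΔ
  -- A squarefree monomial of degree `suc j` either avoids the first variable, or contains it and
  -- comes from a monomial of degree `j` in `Δ f`.
  A : ℕ → ℤ
  A zero    = A₀ zero
  A (suc j) = A₀ (suc j) ℤ.+ A′ j
  A-vanishes : ∀ j → suc m < j → A j ≡ 0ℤ
  A-vanishes (suc j) (s≤s m<j) =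
    cong₂ ℤ._+_ (proj₁ (proj₂ ih₀) (suc j) (ℕ.m<n⇒m<1+n m<j)) (proj₁ (proj₂ ihΔ) j m<j)

  -- With f₁ = f₀ + `Δ f`, the coefficients of f₀ occur for subsets of size `suc k` and of size `k`,
  -- and Pascal's rule joins the two. Beyond its range `suc j ≤ m` the coefficient `A₀ (suc j)` is
  -- zero, which is why vanishing is part of the statement.
  merge : ∀ k j →
    (A₀ (suc j) ℤ.* + supersets m (suc j) (suc k) ℤ.+ A₀ (suc j) ℤ.* + supersets m (suc j) k)
      ℤ.+ A′ j ℤ.* + supersets m j k ≡ A (suc j) ℤ.* + supersets m j k
  merge k j with ℕ.≤-<-connex (suc j) m
  ... | inj₁ j<m = trans
    (cong (λ t → t ℤ.+ A′ j ℤ.* + supersets m j k)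
      (trans (sym (ℤ.*-distribˡ-+ (A₀ (suc j)) _ _))
             (cong (λ c → A₀ (suc j) ℤ.* + c) (trans (ℕ.+-comm (supersets m (suc j) (suc k)) _) (sym (supersets-pascal m (suc j) k j<m))))))
    (sym (ℤ.*-distribʳ-+ (+ supersets m j k) (A₀ (suc j)) (A′ j)))
  ... | inj₂ m<j rewrite proj₁ (proj₂ ih₀) (suc j) m<j =
    trans (ℤ.+-identityˡ _) (cong (λ t → t ℤ.* + supersets m j k) (sym (ℤ.+-identityˡ (A′ j))))

  formula : ∀ k → sliceSum k f ≡ ∑ (suc e) (λ j → A j ℤ.* + supersets (suc m) j k)
  formula zero = trans (proj₂ (proj₂ ih₀) 0) (cong₂ ℤ._+_
    (cong (λ c → A₀ 0 ℤ.* + c) (trans (nC0≡1 m) (sym (nC0≡1 (suc m)))))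
    (trans (∑-zero e (λ j → trans (cong (λ c → A₀ (suc j) ℤ.* + c) (supersets-zero m j)) (ℤ.*-zeroʳ (A₀ (suc j)))))
           (sym (∑-zero e (λ j → ℤ.*-zeroʳ (A (suc j)))))))
  formula (suc k) = begin
    sliceSum (suc k) f₀ ℤ.+ sliceSum k f₁
      ≡⟨ cong (λ t → sliceSum (suc k) f₀ ℤ.+ t) (sliceSum-Δ k f₁ f₀) ⟩
    sliceSum (suc k) f₀ ℤ.+ (sliceSum k f₀ ℤ.+ sliceSum k (Δ f))
      ≡⟨ cong₂ ℤ._+_ (proj₂ (proj₂ ih₀) (suc k)) (cong₂ ℤ._+_ (proj₂ (proj₂ ih₀) k) (proj₂ (proj₂ ihΔ) k)) ⟩
    (t₁ 0 ℤ.+ ∑ e (t₁ ∘ suc)) ℤ.+ ((t₂ 0 ℤ.+ ∑ e (t₂ ∘ suc)) ℤ.+ ∑ e t₃)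
      ≡⟨ regroup (t₁ 0) (∑ e (t₁ ∘ suc)) (t₂ 0) (∑ e (t₂ ∘ suc)) (∑ e t₃) ⟩
    (t₁ 0 ℤ.+ t₂ 0) ℤ.+ ((∑ e (t₁ ∘ suc) ℤ.+ ∑ e (t₂ ∘ suc)) ℤ.+ ∑ e t₃)
      ≡⟨ cong (λ t → (t₁ 0 ℤ.+ t₂ 0) ℤ.+ (t ℤ.+ ∑ e t₃)) (∑-+ e (t₁ ∘ suc) (t₂ ∘ suc)) ⟨
    (t₁ 0 ℤ.+ t₂ 0) ℤ.+ (∑ e (λ j → t₁ (suc j) ℤ.+ t₂ (suc j)) ℤ.+ ∑ e t₃)
      ≡⟨ cong (λ t → (t₁ 0 ℤ.+ t₂ 0) ℤ.+ t) (∑-+ e (λ j → t₁ (suc j) ℤ.+ t₂ (suc j)) t₃) ⟨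
    (t₁ 0 ℤ.+ t₂ 0) ℤ.+ ∑ e (λ j → (t₁ (suc j) ℤ.+ t₂ (suc j)) ℤ.+ t₃ j)
      ≡⟨ cong₂ ℤ._+_ head (∑-cong e (merge k)) ⟩
    A₀ 0 ℤ.* + (suc m C suc k) ℤ.+ ∑ e (λ j → A (suc j) ℤ.* + supersets m j k) ∎
    where
    t₁ t₂ t₃ : ℕ → ℤ
    t₁ j = A₀ j ℤ.* + supersets m j (suc k)
    t₂ j = A₀ j ℤ.* + supersets m j k
    t₃ j = A′ j ℤ.* + supersets m j k
    head : t₁ 0 ℤ.+ t₂ 0 ≡ A₀ 0 ℤ.* + (suc m C suc k)
    head = trans (sym (ℤ.*-distribˡ-+ (A₀ 0) _ _))
      (cong (λ c → A₀ 0 ℤ.* + c) (trans (ℕ.+-comm (m C suc k) _) (sym (pascal m k))))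
    regroup : ∀ a b c d e → (a ℤ.+ b) ℤ.+ ((c ℤ.+ d) ℤ.+ e) ≡ (a ℤ.+ c) ℤ.+ ((b ℤ.+ d) ℤ.+ e)
    regroup = ℤSolver.solve-∀

-- Exchanging neighbouring coordinates

data Place : ℕ → Set where
  here  : Place n
  there : Place n → Place (suc n)

insert₂ : Bool → Bool → Place n → Vec Bool n → Vec Bool (suc (suc n))
insert₂ a b here      z       = a ∷ b ∷ z
insert₂ a b (there i) (c ∷ z) = c ∷ insert₂ a b i z

weight-insert₂ : ∀ a b (i : Place n) z → weight (insert₂ a b i z) ≡ (bit a + bit b) + weight z
weight-insert₂ a b here z =
  trans (weight-∷ a (b ∷ z)) (trans (cong (λ v → bit a + v) (weight-∷ b z)) (sym (ℕ.+-assoc (bit a) (bit b) _)))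
weight-insert₂ a b (there i) (true  ∷ z) = trans (cong suc (weight-insert₂ a b i z)) (sym (ℕ.+-suc _ _))
weight-insert₂ a b (there i) (false ∷ z) = weight-insert₂ a b i z

exchange : Place n → CubeFun (suc (suc n)) → CubeFun n
exchange i f z = f (insert₂ true false i z) ℤ.- f (insert₂ false true i z)

-- In the multilinear form the terms containing both or neither of the two variables cancel. What
-- remains is the coefficient of one variable minus that of the other, so the degree drops by one.
Degree<-exchange : ∀ e (i : Place n) (f : CubeFun (suc (suc n))) → Degree< (suc e) f → Degree< e (exchange i f)
Degree<-exchange e here f ((df₀₀ , dΔ₀) , dΔ) =
  Degree<-cong e (λ z → regroup (f (true ∷ false ∷ z)) (f (false ∷ false ∷ z)) (f (false ∷ true ∷ z)))
    (Degree<-comb e 1ℤ (ℤ.- 1ℤ) (Degree<-false e dΔ) dΔ₀)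
  where
  regroup : ∀ a b c → 1ℤ ℤ.* (a ℤ.- b) ℤ.+ (ℤ.- 1ℤ) ℤ.* (c ℤ.- b) ≡ a ℤ.- c
  regroup = ℤSolver.solve-∀
-- For `e = 0` the goal is a pointwise equation and not a pair, so both values of the first
-- coordinate are treated.
Degree<-exchange zero (there i) f df (false ∷ z) = Degree<-exchange zero i (f ∘ (false ∷_)) (proj₁ df) z
Degree<-exchange zero (there i) f df (true  ∷ z) =
  Degree<-exchange zero i (f ∘ (true ∷_)) (Degree<-true 1 {f} df) z
Degree<-exchange (suc e) (there i) f (df₀ , dΔ) =
  Degree<-exchange (suc e) i (f ∘ (false ∷_)) df₀ ,
  Degree<-cong e (λ z → regroup (f (true ∷ insert₂ true false i z)) (f (false ∷ insert₂ true false i z))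
                                (f (true ∷ insert₂ false true i z)) (f (false ∷ insert₂ false true i z)))
    (Degree<-exchange e i (Δ f) dΔ)
  where
  regroup : ∀ a b c d → (a ℤ.- b) ℤ.- (c ℤ.- d) ≡ (a ℤ.- c) ℤ.- (b ℤ.- d)
  regroup = ℤSolver.solve-∀

data _∼_ : Vec Bool n → Vec Bool n → Set where
  swap : (i : Place n) (z : Vec Bool n) → insert₂ true false i z ∼ insert₂ false true i z

∷-∼ : ∀ b {u v : Vec Bool n} → u ∼ v → (b ∷ u) ∼ (b ∷ v)
∷-∼ b (swap i z) = swap (there i) (b ∷ z)

vectorOfWeight : ∀ n k → k ≤ n → ∃ λ (z : Vec Bool n) → weight z ≡ k
vectorOfWeight n k k≤n with subcubeWith n 0 k k≤n
... | s , eq = point s [] , trans (weight-point s []) (trans (ℕ.+-identityʳ _) eq)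

-- Signs and binomial sums

sgn : ℕ → ℤ
sgn zero    = 1ℤ
sgn (suc n) = ℤ.- sgn n

sgn-square : ∀ n → sgn n ℤ.* sgn n ≡ 1ℤ
sgn-square zero    = refl
sgn-square (suc n) = trans (regroup (sgn n)) (sgn-square n)
  where
  regroup : ∀ s → (ℤ.- s) ℤ.* (ℤ.- s) ≡ s ℤ.* s
  regroup = ℤSolver.solve-∀

sgn-+ : ∀ m n → sgn (m + n) ≡ sgn m ℤ.* sgn n
sgn-+ zero    n = sym (ℤ.*-identityˡ (sgn n))
sgn-+ (suc m) n = trans (cong ℤ.-_ (sgn-+ m n)) (ℤ.neg-distribˡ-* (sgn m) (sgn n))

-- The value at any point of weight `k` of the sum of `a j` times the elementary symmetric
-- polynomial of degree `j`, over `j < e`.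
binomialSum : ℕ → (ℕ → ℤ) → ℕ → ℤ
binomialSum e a k = ∑ e (λ j → a j ℤ.* + (k C j))

-- Congruence modulo p

module Congruence (p : ℕ) where

  infix 4 _≋_
  -- A record lets unification recover `a` and `b`, which the bare difference would not.
  record _≋_ (a b : ℤ) : Set where
    constructor mod
    field
      ∣difference : + p ℤ∣.∣ a ℤ.- b

  ≋-reflexive : ∀ {a b} → a ≡ b → a ≋ b
  ≋-reflexive {a} refl = mod (ℤ∣.divides 0ℤ (ℤ.+-inverseʳ a))

  ≋-refl : ∀ {a} → a ≋ a
  ≋-refl = ≋-reflexive refl

  ≋-sym : ∀ {a b} → a ≋ b → b ≋ a
  ≋-sym {a} {b} (mod a≋b) = mod (subst (+ p ℤ∣.∣_) (regroup a b) (ℤ∣.∣m⇒∣-m a≋b))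
    where
    regroup : ∀ a b → ℤ.- (a ℤ.- b) ≡ b ℤ.- a
    regroup = ℤSolver.solve-∀

  ≋-trans : ∀ {a b c} → a ≋ b → b ≋ c → a ≋ c
  ≋-trans {a} {b} {c} (mod a≋b) (mod b≋c) = mod (subst (+ p ℤ∣.∣_) (regroup a b c) (ℤ∣.∣m∣n⇒∣m+n a≋b b≋c))
    where
    regroup : ∀ a b c → (a ℤ.- b) ℤ.+ (b ℤ.- c) ≡ a ℤ.- c
    regroup = ℤSolver.solve-∀

  ≋-setoid : Setoid _ _
  ≋-setoid = record { Carrier = ℤ ; _≈_ = _≋_
    ; isEquivalence = record { refl = ≋-refl ; sym = ≋-sym ; trans = ≋-trans } }

  module ≋-Reasoning = SetoidReasoning ≋-setoid

  +-cong-≋ : ∀ {a b c d} → a ≋ b → c ≋ d → a ℤ.+ c ≋ b ℤ.+ d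
  +-cong-≋ {a} {b} {c} {d} (mod a≋b) (mod c≋d) = mod (subst (+ p ℤ∣.∣_) (regroup a b c d) (ℤ∣.∣m∣n⇒∣m+n a≋b c≋d))
    where
    regroup : ∀ a b c d → (a ℤ.- b) ℤ.+ (c ℤ.- d) ≡ (a ℤ.+ c) ℤ.- (b ℤ.+ d)
    regroup = ℤSolver.solve-∀

  *-congˡ-≋ : ∀ a {b c} → b ≋ c → a ℤ.* b ≋ a ℤ.* c
  *-congˡ-≋ a {b} {c} (mod b≋c) = mod (subst (+ p ℤ∣.∣_) (regroup a b c) (ℤ∣.∣n⇒∣m*n a b≋c))
    where
    regroup : ∀ a b c → a ℤ.* (b ℤ.- c) ≡ a ℤ.* b ℤ.- a ℤ.* c
    regroup = ℤSolver.solve-∀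

  *-congʳ-≋ : ∀ {b c} a → b ≋ c → b ℤ.* a ≋ c ℤ.* a
  *-congʳ-≋ {b} {c} a (mod b≋c) = mod (subst (+ p ℤ∣.∣_) (regroup a b c) (ℤ∣.∣m⇒∣m*n a b≋c))
    where
    regroup : ∀ a b c → (b ℤ.- c) ℤ.* a ≡ b ℤ.* a ℤ.- c ℤ.* a
    regroup = ℤSolver.solve-∀

  +-cancelˡ-≋ : ∀ {a b c d} → a ℤ.+ b ≋ c ℤ.+ d → a ≋ c → b ≋ d
  +-cancelˡ-≋ {a} {b} {c} {d} (mod ab≋cd) (mod a≋c) = mod (subst (+ p ℤ∣.∣_) (regroup a b c d) (ℤ∣.∣m∣n⇒∣m-n ab≋cd a≋c))
    where
    regroup : ∀ a b c d → ((a ℤ.+ b) ℤ.- (c ℤ.+ d)) ℤ.- (a ℤ.- c) ≡ b ℤ.- d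
    regroup = ℤSolver.solve-∀

  ∣⇒≋0 : ∀ {a} → + p ℤ∣.∣ a → a ≋ 0ℤ
  ∣⇒≋0 {a} p∣a = mod (subst (+ p ℤ∣.∣_) (sym (ℤ.+-identityʳ a)) p∣a)

  ≋0⇒∣ : ∀ {a} → a ≋ 0ℤ → + p ℤ∣.∣ a
  ≋0⇒∣ {a} (mod p∣a-0) = subst (+ p ℤ∣.∣_) (ℤ.+-identityʳ a) p∣a-0

  ∣-resp-≋ : ∀ {a b} → a ≋ b → + p ℤ∣.∣ a → + p ℤ∣.∣ b
  ∣-resp-≋ a≋b p∣a = ≋0⇒∣ (≋-trans (≋-sym a≋b) (∣⇒≋0 p∣a))

  ∣sgn*⇒∣ : ∀ n {a} → + p ℤ∣.∣ sgn n ℤ.* a → + p ℤ∣.∣ a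
  ∣sgn*⇒∣ n {a} p∣sa = subst (+ p ℤ∣.∣_) cancel (ℤ∣.∣n⇒∣m*n (sgn n) p∣sa)
    where
    cancel : sgn n ℤ.* (sgn n ℤ.* a) ≡ a
    cancel = trans (sym (ℤ.*-assoc (sgn n) (sgn n) a))
      (trans (cong (ℤ._* a) (sgn-square n)) (ℤ.*-identityˡ a))

  ∑-cong-≋ : ∀ e {g h} → (∀ j → j < e → g j ≋ h j) → ∑ e g ≋ ∑ e h
  ∑-cong-≋ zero    g≋h = ≋-refl
  ∑-cong-≋ (suc e) g≋h = +-cong-≋ (g≋h 0 (s≤s z≤n)) (∑-cong-≋ e (λ j j<e → g≋h (suc j) (s≤s j<e)))

  sliceSum-cong-≋ : ∀ k {f g : CubeFun n} → (∀ x → weight x ≡ k → f x ≋ g x) → sliceSum k f ≋ sliceSum k g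
  sliceSum-cong-≋ {zero}  zero    f≋g = f≋g [] refl
  sliceSum-cong-≋ {zero}  (suc k) f≋g = ≋-refl
  sliceSum-cong-≋ {suc n} zero    f≋g = sliceSum-cong-≋ {n} zero (λ x → f≋g (false ∷ x))
  sliceSum-cong-≋ {suc n} (suc k) f≋g = +-cong-≋
    (sliceSum-cong-≋ {n} (suc k) (λ x → f≋g (false ∷ x)))
    (sliceSum-cong-≋ {n} k (λ x w → f≋g (true ∷ x) (cong suc w)))

  ∣-sliceSum : ∀ k {f : CubeFun n} → (∀ x → weight x ≡ k → + p ℤ∣.∣ f x) → + p ℤ∣.∣ sliceSum k f
  ∣-sliceSum {n} k {f} p∣f = ∣-resp-≋
    (≋-sym (≋-trans (sliceSum-cong-≋ k (λ x w → ∣⇒≋0 (p∣f x w))) (≋-reflexive (sliceSum-zero {n} k {λ _ → 0ℤ} (λ _ → refl)))))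
    (ℤ∣.divides 0ℤ refl)

  -- Equal first bits are peeled off. If the first bits differ, the path runs through
  -- `true ∷ false ∷ z` and `false ∷ true ∷ z`, which one exchange at the front connects.
  slice-constant : ∀ k (f : CubeFun n) → (∀ {u v} → u ∼ v → weight u ≡ k → f u ≋ f v) →
                   ∀ x y → weight x ≡ k → weight y ≡ k → f x ≋ f y
  slice-constant-mixed : ∀ k (f : CubeFun (suc n)) → (∀ {u v} → u ∼ v → weight u ≡ k → f u ≋ f v) →
    ∀ x y → weight (true ∷ x) ≡ k → weight (false ∷ y) ≡ k → f (true ∷ x) ≋ f (false ∷ y)

  slice-constant k f inv [] [] _ _ = ≋-refl
  slice-constant k f inv (true ∷ x) (true ∷ y) refl eq =
    slice-constant (weight x) (f ∘ (true ∷_)) (λ s w → inv (∷-∼ true s) (cong suc w)) x y refl (ℕ.suc-injective eq)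
  slice-constant k f inv (false ∷ x) (false ∷ y) ex ey =
    slice-constant k (f ∘ (false ∷_)) (λ s → inv (∷-∼ false s)) x y ex ey
  slice-constant {suc n} k f inv (true ∷ x) (false ∷ y) ex ey = slice-constant-mixed k f inv x y ex ey
  slice-constant {suc n} k f inv (false ∷ x) (true ∷ y) ex ey = ≋-sym (slice-constant-mixed k f inv y x ey ex)

  slice-constant-mixed {zero} k f inv [] [] refl ()
  slice-constant-mixed {suc n} k f inv x y refl ey = begin
    f (true ∷ x)
      ≈⟨ slice-constant (weight x) (f ∘ (true ∷_)) (λ s w → inv (∷-∼ true s) (cong suc w)) x (false ∷ z) refl wz ⟩
    f (true ∷ false ∷ z)
      ≈⟨ inv (swap here z) (cong suc wz) ⟩
    f (false ∷ true ∷ z)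
      ≈⟨ slice-constant (suc (weight x)) (f ∘ (false ∷_)) (λ s → inv (∷-∼ false s)) (true ∷ z) y (cong suc wz) ey ⟩
    f (false ∷ y) ∎
    where
    open ≋-Reasoning
    -- Such a `z` exists because `y` has weight `suc (weight x)` and length `suc n`.
    z = proj₁ (vectorOfWeight n (weight x) (ℕ.≤-pred (subst (_≤ suc n) ey (count≤n _ y))))
    wz = proj₂ (vectorOfWeight n (weight x) (ℕ.≤-pred (subst (_≤ suc n) ey (count≤n _ y))))

  -- Taking Q = q − 1 as the parameter makes q nonzero by construction.
  module Period (Q : ℕ) (p∣qC : ∀ i → suc i < suc Q → + p ℤ∣.∣ + (suc Q C suc i)) where

    -- Lucas-type congruences and sums over slices

    q : ℕ
    q = suc Q

    -- This is (1 + X)^(q + a) ≡ (1 + X^q)(1 + X)^a read below degree `q`. The case `a = 0` is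
    -- `p∣qC`, and Pascal's rule gives the rest.
    [q+a]Cb≋aCb : ∀ a b → b < q → + ((q + a) C b) ≋ + (a C b)
    [q+a]Cb≋aCb a zero _ = ≋-reflexive (cong +_ (trans (nC0≡1 (q + a)) (sym (nC0≡1 a))))
    [q+a]Cb≋aCb zero (suc b) b<q rewrite ℕ.+-identityʳ Q =
      ≋-trans (∣⇒≋0 (p∣qC b b<q)) (≋-reflexive (cong +_ (sym (k>n⇒nCk≡0 {0} {suc b} (s≤s z≤n)))))
    [q+a]Cb≋aCb (suc a) (suc b) b<q = begin
      + ((q + suc a) C suc b)               ≡⟨ cong (λ N → + (N C suc b)) (ℕ.+-suc q a) ⟩
      + (suc (q + a) C suc b)               ≡⟨ cong +_ (pascal (q + a) b) ⟩
      + ((q + a) C b + (q + a) C suc b)     ≈⟨ +-cong-≋ ([q+a]Cb≋aCb a b (ℕ.<-trans (ℕ.n<1+n b) b<q)) ([q+a]Cb≋aCb a (suc b) b<q) ⟩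
      + (a C b + a C suc b)                 ≡⟨ cong +_ (pascal a b) ⟨
      + (suc a C suc b)                     ∎
      where open ≋-Reasoning

    -- The value is 1 at `a = 0`, and by Pascal's rule the increment is congruent to `a C Q`, which
    -- is zero for `a < Q`.
    [q+a]Cq≋1 : ∀ a → a < q → + ((q + a) C q) ≋ 1ℤ
    [q+a]Cq≋1 zero _ rewrite ℕ.+-identityʳ Q = ≋-reflexive (cong +_ (nCn≡1 q))
    [q+a]Cq≋1 (suc a) (s≤s a<Q) = begin
      + ((q + suc a) C q)                ≡⟨ cong (λ N → + (N C q)) (ℕ.+-suc q a) ⟩
      + (suc (q + a) C suc Q)            ≡⟨ cong +_ (pascal (q + a) Q) ⟩
      + ((q + a) C Q + (q + a) C q)      ≈⟨ +-cong-≋ ([q+a]Cb≋aCb a Q (ℕ.n<1+n Q)) ([q+a]Cq≋1 a (ℕ.m<n⇒m<1+n a<Q)) ⟩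
      + (a C Q) ℤ.+ 1ℤ                   ≡⟨ cong (λ c → + c ℤ.+ 1ℤ) (k>n⇒nCk≡0 a<Q) ⟩
      1ℤ                                 ∎
      where open ≋-Reasoning

    -- Neighbouring entries of row `Q` add up to an inner entry of row `q`, which is divisible by
    -- `p`, so the signs alternate.
    QCi≋sgn : ∀ i → i ≤ Q → + (Q C i) ≋ sgn i
    QCi≋sgn zero    _   = ≋-reflexive (cong +_ (nC0≡1 Q))
    QCi≋sgn (suc i) i<Q = +-cancelˡ-≋ {a = + (Q C i)} {c = sgn i} (begin
      + (Q C i + Q C suc i)  ≡⟨ cong +_ (pascal Q i) ⟨
      + (q C suc i)          ≈⟨ ∣⇒≋0 (p∣qC i (s≤s i<Q)) ⟩
      0ℤ                     ≡⟨ ℤ.+-inverseʳ (sgn i) ⟨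
      sgn i ℤ.+ sgn (suc i)  ∎) (QCi≋sgn i (ℕ.<⇒≤ i<Q))
      where open ≋-Reasoning

    -- Modulo p the binomial (q − 1 − j) C i behaves like (−1 − j) C i.
    aCi≋± : ∀ j i a → a + j ≡ Q → i ≤ a → + (a C i) ≋ sgn i ℤ.* + ((i + j) C j)
    aCi≋± zero i a a+0≡Q i≤a = subst (λ N → + (N C i) ≋ sgn i ℤ.* + ((i + 0) C 0)) (sym a≡Q)
      (≋-trans (QCi≋sgn i (subst (i ≤_) a≡Q i≤a))
        (≋-reflexive (sym (trans (cong (λ c → sgn i ℤ.* + c) (nC0≡1 (i + 0))) (ℤ.*-identityʳ (sgn i))))))
      where
      a≡Q : a ≡ Q
      a≡Q = trans (sym (ℕ.+-identityʳ a)) a+0≡Q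
    aCi≋± (suc j) zero a _ _ =
      ≋-reflexive (trans (cong +_ (nC0≡1 a)) (cong (λ c → 1ℤ ℤ.* + c) (sym (nCn≡1 (suc j)))))
    -- In Pascal's rule `a C i` is known by induction on `i`, and `suc a C suc i` by induction on
    -- `j`; cancellation leaves `a C suc i`.
    aCi≋± (suc j) (suc i) a a+sj≡Q i<a =
      +-cancelˡ-≋ {a = + (a C i)} {c = sgn i ℤ.* + ((i + suc j) C suc j)} total (aCi≋± (suc j) i a a+sj≡Q (ℕ.<⇒≤ i<a))
      where
      open ≋-Reasoning
      total : + (a C i) ℤ.+ + (a C suc i) ≋
              sgn i ℤ.* + ((i + suc j) C suc j) ℤ.+ sgn (suc i) ℤ.* + ((suc i + suc j) C suc j)
      total = begin
        + (a C i + a C suc i)                   ≡⟨ cong +_ (pascal a i) ⟨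
        + (suc a C suc i)                       ≈⟨ aCi≋± j (suc i) (suc a) (trans (sym (ℕ.+-suc a j)) a+sj≡Q) (ℕ.m≤n⇒m≤1+n i<a) ⟩
        sgn (suc i) ℤ.* + ((suc i + j) C j)     ≡⟨ cong (λ N → sgn (suc i) ℤ.* + (N C j)) (ℕ.+-suc i j) ⟨
        sgn (suc i) ℤ.* + ((i + suc j) C j)     ≡⟨ regroup (sgn i) (+ ((i + suc j) C j)) (+ ((i + suc j) C suc j)) ⟩
        sgn i ℤ.* + ((i + suc j) C suc j) ℤ.+ sgn (suc i) ℤ.* + ((i + suc j) C j + (i + suc j) C suc j)
                                                ≡⟨ cong (λ c → sgn i ℤ.* + ((i + suc j) C suc j) ℤ.+ sgn (suc i) ℤ.* + c) (pascal (i + suc j) j) ⟨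
        sgn i ℤ.* + ((i + suc j) C suc j) ℤ.+ sgn (suc i) ℤ.* + ((suc i + suc j) C suc j) ∎
        where
        regroup : ∀ s c c′ → (ℤ.- s) ℤ.* c ≡ s ℤ.* c′ ℤ.+ (ℤ.- s) ℤ.* (c ℤ.+ c′)
        regroup = ℤSolver.solve-∀

    -- Only binomials with lower index below `q` occur, and each of them has period `q` modulo `p`.
    binomialSum-periodic : ∀ e → e ≤ q → ∀ a t k → binomialSum e a (t * q + k) ≋ binomialSum e a k
    binomialSum-periodic e e≤q a zero    k = ≋-refl
    binomialSum-periodic e e≤q a (suc t) k = begin
      binomialSum e a (q + t * q + k)   ≡⟨ cong (binomialSum e a) (ℕ.+-assoc q (t * q) k) ⟩
      binomialSum e a (q + (t * q + k)) ≈⟨ ∑-cong-≋ e (λ j j<e → *-congˡ-≋ (a j) ([q+a]Cb≋aCb (t * q + k) j (ℕ.<-≤-trans j<e e≤q))) ⟩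
      binomialSum e a (t * q + k)       ≈⟨ binomialSum-periodic e e≤q a t k ⟩
      binomialSum e a k                 ∎
      where open ≋-Reasoning

    -- A monomial of degree `j` is counted once at the top. In slice `δ` it is counted (q + δ - j) C
    -- (δ - j) times, which is congruent to (δ - j) C (δ - j) = 1.
    top≋sliceSum : ∀ δ → δ < q → (f : CubeFun (q + δ)) → Degree< (suc δ) f →
                   f (allTrue (q + δ)) ≋ sliceSum δ f
    top≋sliceSum δ δ<q f df with sliceSum-formula (suc δ) f df
    ... | A , _ , formula = begin
      f (allTrue (q + δ))                                       ≡⟨ sliceSum-top f ⟨
      sliceSum (q + δ) f                                        ≡⟨ formula (q + δ) ⟩
      ∑ (suc δ) (λ j → A j ℤ.* + supersets (q + δ) j (q + δ))   ≈⟨ ∑-cong-≋ (suc δ) (λ j j≤δ → *-congˡ-≋ (A j) (term j j≤δ)) ⟩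
      ∑ (suc δ) (λ j → A j ℤ.* + supersets (q + δ) j δ)         ≡⟨ formula δ ⟨
      sliceSum δ f                                              ∎
      where
      open ≋-Reasoning
      shift : ∀ q j t → q + (j + t) ≡ j + (q + t)
      shift = ℕSolver.solve-∀
      term : ∀ j → j < suc δ → + supersets (q + δ) j (q + δ) ≋ + supersets (q + δ) j δ
      term j (s≤s j≤δ) with ℕ.m≤n⇒∃[o]m+o≡n j≤δ
      ... | t , refl = begin
        + supersets (q + (j + t)) j (q + (j + t)) ≡⟨ cong (λ M → + supersets M j M) (shift q j t) ⟩
        + supersets (j + (q + t)) j (j + (q + t)) ≡⟨ cong +_ (trans (supersets-+ j (q + t) (q + t)) (nCn≡1 (q + t))) ⟩
        1ℤ                                        ≡⟨ cong +_ (nCn≡1 t) ⟨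
        + (t C t)                                 ≈⟨ [q+a]Cb≋aCb t t (ℕ.≤-<-trans (ℕ.m≤n+m t j) δ<q) ⟨
        + ((q + t) C t)                           ≡⟨ cong +_ (supersets-+ j (q + t) t) ⟨
        + supersets (j + (q + t)) j (j + t)       ≡⟨ cong (λ M → + supersets M j (j + t)) (shift q j t) ⟨
        + supersets (q + (j + t)) j (j + t)       ∎

    -- Only the constant term survives at the bottom. In slice `q` a monomial of degree `j > 0` is
    -- counted (q + δ - j) C (q - j) times, congruent to (δ - j) C (q - j), which is zero since
    -- `δ < q`.
    bottom≋sliceSum : ∀ δ → δ < q → (f : CubeFun (q + δ)) → Degree< (suc δ) f →
                      f (allFalse (q + δ)) ≋ sliceSum q f
    bottom≋sliceSum δ δ<q f df with sliceSum-formula (suc δ) f df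
    ... | A , _ , formula = begin
      f (allFalse (q + δ))                                      ≡⟨ sliceSum-bottom f ⟨
      sliceSum 0 f                                              ≡⟨ formula 0 ⟩
      ∑ (suc δ) (λ j → A j ℤ.* + supersets (q + δ) j 0)         ≈⟨ ∑-cong-≋ (suc δ) (λ j j≤δ → *-congˡ-≋ (A j) (term j j≤δ)) ⟩
      ∑ (suc δ) (λ j → A j ℤ.* + supersets (q + δ) j q)         ≡⟨ formula q ⟨
      sliceSum q f                                              ∎
      where
      open ≋-Reasoning
      shift : ∀ q j t → q + (j + t) ≡ j + (q + t)
      shift = ℕSolver.solve-∀
      term : ∀ j → j < suc δ → + supersets (q + δ) j 0 ≋ + supersets (q + δ) j q
      -- For `j = 0` the lower index equals `q`, just outside the range of `[q+a]Cb≋aCb`.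
      term zero    _         = ≋-trans (≋-reflexive (cong +_ (nC0≡1 (q + δ)))) (≋-sym ([q+a]Cq≋1 δ δ<q))
      term (suc j) (s≤s j<δ) with ℕ.m≤n⇒∃[o]m+o≡n j<δ | ℕ.m≤n⇒∃[o]m+o≡n (ℕ.<⇒≤ (ℕ.≤-<-trans j<δ δ<q))
      ... | t , refl | i , sj+i≡q = begin
        + supersets (q + (suc j + t)) (suc j) 0           ≡⟨ cong +_ (supersets-zero (q + (suc j + t)) j) ⟩
        0ℤ                                                ≡⟨ cong +_ (k>n⇒nCk≡0 t<i) ⟨
        + (t C i)                                         ≈⟨ [q+a]Cb≋aCb t i i<q ⟨
        + ((q + t) C i)                                   ≡⟨ cong +_ (supersets-+ (suc j) (q + t) i) ⟨
        + supersets (suc j + (q + t)) (suc j) (suc j + i) ≡⟨ cong₂ (λ M k → + supersets M (suc j) k) (sym (shift q (suc j) t)) sj+i≡q ⟩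
        + supersets (q + (suc j + t)) (suc j) q           ∎
        where
        t<i : t < i
        t<i = ℕ.+-cancelˡ-< (suc j) t i (subst (suc j + t <_) (sym sj+i≡q) δ<q)
        i<q : i < q
        i<q = subst (i <_) sj+i≡q (s≤s (ℕ.m≤n+m i j))

    -- Since Q C r = ±1 modulo p, the slices of the (q − 1)-cube can be averaged over.
    sliceSum≋binomialSum : ∀ e → e ≤ q → (f : CubeFun Q) → Degree< e f → Σ (ℕ → ℤ) λ a →
      ∀ r → r ≤ Q → sliceSum r f ≋ sgn r ℤ.* binomialSum e a r
    sliceSum≋binomialSum e e≤q f df with sliceSum-formula e f df
    -- For `j ≤ r` the count (Q - j) C (r - j) is congruent to `sgn (r ∸ j)` times `r C j`. That
    -- sign is `sgn r` times `sgn j`; the second factor goes into the coefficient.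
    ... | A , _ , formula = (λ j → sgn j ℤ.* A j) , λ r r≤Q → begin
      sliceSum r f                                                 ≡⟨ formula r ⟩
      ∑ e (λ j → A j ℤ.* + supersets Q j r)                        ≈⟨ ∑-cong-≋ e (λ j j<e → term r r≤Q j (ℕ.<-≤-trans j<e e≤q)) ⟩
      ∑ e (λ j → sgn r ℤ.* (sgn j ℤ.* A j ℤ.* + (r C j)))          ≡⟨ ∑-*ˡ e (sgn r) _ ⟩
      sgn r ℤ.* binomialSum e (λ j → sgn j ℤ.* A j) r              ∎
      where
      open ≋-Reasoning
      term : ∀ r → r ≤ Q → ∀ j → j < q → A j ℤ.* + supersets Q j r ≋ sgn r ℤ.* (sgn j ℤ.* A j ℤ.* + (r C j))
      term r r≤Q j (s≤s j≤Q) with ℕ.≤-<-connex j r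
      ... | inj₂ r<j = ≋-reflexive (trans
        (trans (cong (λ c → A j ℤ.* + c) (supersets-< Q j r r<j)) (ℤ.*-zeroʳ (A j)))
        (sym (trans (cong (λ c → sgn r ℤ.* (sgn j ℤ.* A j ℤ.* + c)) (k>n⇒nCk≡0 r<j))
                    (trans (cong (sgn r ℤ.*_) (ℤ.*-zeroʳ (sgn j ℤ.* A j))) (ℤ.*-zeroʳ (sgn r))))))
      ... | inj₁ j≤r with ℕ.m≤n⇒∃[o]m+o≡n j≤r | ℕ.m≤n⇒∃[o]m+o≡n j≤Q
      ...   | i , refl | a , refl = begin
        A j ℤ.* + supersets (j + a) j (j + i)                    ≡⟨ cong (λ c → A j ℤ.* + c) (supersets-+ j a i) ⟩
        A j ℤ.* + (a C i)                                        ≈⟨ *-congˡ-≋ (A j) (aCi≋± j i a (ℕ.+-comm a j) (ℕ.+-cancelˡ-≤ j i a r≤Q)) ⟩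
        A j ℤ.* (sgn i ℤ.* + ((i + j) C j))                      ≡⟨ cong (λ N → A j ℤ.* (sgn i ℤ.* + (N C j))) (ℕ.+-comm i j) ⟩
        A j ℤ.* (sgn i ℤ.* c)                                    ≡⟨ ℤ.*-identityˡ _ ⟨
        1ℤ ℤ.* (A j ℤ.* (sgn i ℤ.* c))                           ≡⟨ cong (ℤ._* (A j ℤ.* (sgn i ℤ.* c))) (sgn-square j) ⟨
        (sgn j ℤ.* sgn j) ℤ.* (A j ℤ.* (sgn i ℤ.* c))            ≡⟨ regroup (sgn j) (A j) (sgn i) c ⟩
        (sgn j ℤ.* sgn i) ℤ.* (sgn j ℤ.* A j ℤ.* c)              ≡⟨ cong (ℤ._* (sgn j ℤ.* A j ℤ.* c)) (sgn-+ j i) ⟨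
        sgn (j + i) ℤ.* (sgn j ℤ.* A j ℤ.* c)                    ∎
        where
        c = + ((j + i) C j)
        regroup : ∀ s A s′ c → (s ℤ.* s) ℤ.* (A ℤ.* (s′ ℤ.* c)) ≡ (s ℤ.* s′) ℤ.* (s ℤ.* A ℤ.* c)
        regroup = ℤSolver.solve-∀

    -- The offset c counts pairs of coordinates, one equal to 1 and one equal to 0,
    -- that have been removed, so that k is the weight in the original cube.
    Vanishes : ℕ → CubeFun n → ℕ → Set
    Vanishes c f k = ∀ x → weight x + c ≡ k → + p ℤ∣.∣ f x

    -- Vanishing along residue classes modulo q

    module Propagation (d N c δ : ℕ) (d<q : d < q) (δ+c≡d : δ + c ≡ d)
                       (f : CubeFun n) (df : Degree< (suc δ) f) (n+2c≡N : n + (c + c) ≡ N) where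

      δ<q : δ < q
      δ<q = ℕ.≤-<-trans (subst (δ ≤_) δ+c≡d (ℕ.m≤m+n δ c)) d<q

      -- The point has at least `q + δ` ones, so it is the top of a subcube of that dimension, whose
      -- slice `δ` lies exactly `q` lower. Degree and offset satisfy `δ + c ≡ d`, which turns
      -- `d ≤ k` into this room.
      step↑ : ∀ k → d ≤ k → Vanishes c f k → Vanishes c f (q + k)
      step↑ k d≤k van x w+c≡q+k with subcubeBelow (q + δ) x q+δ≤w
        where
        open ℕ.≤-Reasoning
        q+δ≤w : q + δ ≤ weight x
        q+δ≤w = ℕ.+-cancelʳ-≤ c (q + δ) (weight x) (begin
          q + δ + c     ≡⟨ ℕ.+-assoc q δ c ⟩
          q + (δ + c)   ≡⟨ cong (λ v → q + v) δ+c≡d ⟩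
          q + d         ≤⟨ ℕ.+-monoʳ-≤ q d≤k ⟩
          q + k         ≡⟨ w+c≡q+k ⟨
          weight x + c  ∎)
      ... | s , refl = ∣-resp-≋ (≋-sym (top≋sliceSum δ δ<q (f ∘ point s) (Degree<-point (suc δ) s df)))
        (∣-sliceSum δ (λ z wz → van (point s z) (ℕ.+-cancelˡ-≡ q _ _ (begin
          q + (weight (point s z) + c)            ≡⟨ cong (λ v → q + (v + c)) (trans (weight-point s z) (cong (λ v → fixedOnes s + v) wz)) ⟩
          q + (fixedOnes s + δ + c)               ≡⟨ regroup q (fixedOnes s) δ c ⟩
          fixedOnes s + (q + δ) + c               ≡⟨ cong (λ v → fixedOnes s + v + c) (weight-allTrue (q + δ)) ⟨
          fixedOnes s + weight (allTrue (q + δ)) + c ≡⟨ cong (_+ c) (weight-point s (allTrue (q + δ))) ⟨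
          weight (point s (allTrue (q + δ))) + c  ≡⟨ w+c≡q+k ⟩
          q + k                                   ∎))))
        where
        open ≡-Reasoning
        regroup : ∀ q o δ c → q + (o + δ + c) ≡ o + (q + δ) + c
        regroup = ℕSolver.solve-∀

      -- Dually, the point is the bottom of a subcube of dimension `q + δ`, whose slice `q` lies `q`
      -- higher. The bound by `N` provides the zeros to be freed, because `n + (c + c) ≡ N`.
      step↓ : ∀ k → q + k + d ≤ N → Vanishes c f (q + k) → Vanishes c f k
      step↓ k q+k+d≤N van x w+c≡k with subcubeAbove (q + δ) x q+δ+w≤n
        where
        open ℕ.≤-Reasoning
        regroup : ∀ q δ w c → q + δ + w + (c + c) ≡ q + (w + c) + (δ + c)
        regroup = ℕSolver.solve-∀
        q+δ+w≤n : q + δ + weight x ≤ n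
        q+δ+w≤n = ℕ.+-cancelʳ-≤ (c + c) (q + δ + weight x) n (begin
          q + δ + weight x + (c + c)       ≡⟨ regroup q δ (weight x) c ⟩
          q + (weight x + c) + (δ + c)     ≡⟨ cong₂ (λ u v → q + u + v) w+c≡k δ+c≡d ⟩
          q + k + d                        ≤⟨ q+k+d≤N ⟩
          N                                ≡⟨ n+2c≡N ⟨
          n + (c + c)                      ∎)
      ... | s , refl = ∣-resp-≋ (≋-sym (bottom≋sliceSum δ δ<q (f ∘ point s) (Degree<-point (suc δ) s df)))
        (∣-sliceSum q (λ z wz → van (point s z) (begin
          weight (point s z) + c                  ≡⟨ cong (_+ c) (trans (weight-point s z) (cong (λ v → fixedOnes s + v) wz)) ⟩
          fixedOnes s + q + c                     ≡⟨ regroup (fixedOnes s) q c ⟩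
          q + (fixedOnes s + 0 + c)               ≡⟨ cong (λ v → q + (fixedOnes s + v + c)) (weight-allFalse (q + δ)) ⟨
          q + (fixedOnes s + weight (allFalse (q + δ)) + c) ≡⟨ cong (λ v → q + (v + c)) (weight-point s (allFalse (q + δ))) ⟨
          q + (weight (point s (allFalse (q + δ))) + c) ≡⟨ cong (λ v → q + v) w+c≡k ⟩
          q + k                                   ∎)))
        where
        open ≡-Reasoning
        regroup : ∀ o q c → o + q + c ≡ q + (o + 0 + c)
        regroup = ℕSolver.solve-∀

      steps↑ : ∀ t k → d ≤ k → Vanishes c f k → Vanishes c f (t * q + k)
      steps↑ zero    k d≤k van = van
      steps↑ (suc t) k d≤k van = subst (Vanishes c f) (sym (ℕ.+-assoc q (t * q) k))
        (step↑ (t * q + k) (ℕ.≤-trans d≤k (ℕ.m≤n+m k (t * q))) (steps↑ t k d≤k van))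

      steps↓ : ∀ t k → t * q + k + d ≤ N → Vanishes c f (t * q + k) → Vanishes c f k
      steps↓ zero    k _ van = van
      steps↓ (suc t) k le van = steps↓ t k (ℕ.≤-trans (ℕ.+-monoˡ-≤ d (ℕ.m≤n+m (t * q + k) q)) le′)
        (step↓ (t * q + k) le′ (subst (Vanishes c f) (ℕ.+-assoc q (t * q) k) van))
        where
        le′ : q + (t * q + k) + d ≤ N
        le′ = subst (λ v → v + d ≤ N) (ℕ.+-assoc q (t * q) k) le

      -- The lower bound on the starting weight serves the moves upwards, the upper bound those
      -- downwards.
      spread : ∀ r t t′ → d ≤ t * q + r → t * q + r + d ≤ N →
               Vanishes c f (t * q + r) → Vanishes c f (t′ * q + r)
      spread r t t′ lower upper van with ℕ.≤-total t t′
      ... | inj₁ t≤t′ with ℕ.m≤n⇒∃[o]m+o≡n t≤t′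
      ...   | u , refl = subst (Vanishes c f) (regroup t u q r) (steps↑ u (t * q + r) lower van)
        where
        regroup : ∀ t u q r → u * q + (t * q + r) ≡ (t + u) * q + r
        regroup = ℕSolver.solve-∀
      spread r t t′ lower upper van | inj₂ t′≤t with ℕ.m≤n⇒∃[o]m+o≡n t′≤t
      ...   | u , refl = steps↓ u (t′ * q + r) (subst (λ v → v + d ≤ N) (regroup t′ u q r) upper)
                           (subst (Vanishes c f) (regroup t′ u q r) van)
        where
        regroup : ∀ t u q r → (t + u) * q + r ≡ u * q + (t * q + r)
        regroup = ℕSolver.solve-∀

    -- Vanishing on the residue class of a point in the symmetric closure

    module Closure (d N : ℕ) (d<q : d < q) (large : q + Q + d ≤ N)
                   (E : ℕ → Set) (E-range : ∀ k → E k → d ≤ k × k + d ≤ N)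
                   (r₀ : ℕ) (r₀≤Q : r₀ ≤ Q)
                   (closed : ∀ a → (∀ k → E k → + p ℤ∣.∣ binomialSum (suc d) a k) → + p ℤ∣.∣ binomialSum (suc d) a r₀)
                   where

      -- The weights from `q` to `q + Q` form a complete residue system inside the range from `d` to
      -- `N − d`. The form `1 * q + r` matches `spread`.
      representative : ∀ r → r ≤ Q → (d ≤ 1 * q + r) × (1 * q + r + d ≤ N)
      representative r r≤Q rewrite ℕ.+-identityʳ Q =
        ℕ.≤-trans (ℕ.<⇒≤ d<q) (ℕ.m≤m+n q r) ,
        ℕ.≤-trans (ℕ.+-monoˡ-≤ d (ℕ.+-monoʳ-≤ q r≤Q)) large

      -- Induction on `e` with `E` and `r₀` unchanged: an exchange lowers `e` by one, raises `c` by
      -- one and removes two coordinates, so both equations persist.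
      vanishes-on-class : ∀ e c (f : CubeFun n) → Degree< e f → e + c ≡ suc d → n + (c + c) ≡ N →
        (∀ k → E k → Vanishes c f k) → ∀ t → Vanishes c f (t * q + r₀)
      vanishes-on-class zero c f df _ _ van t x _ = subst (+ p ℤ∣.∣_) (sym (df x)) (ℤ∣.divides 0ℤ refl)
      vanishes-on-class {n} (suc δ) c f df δ+c≡ n+2c≡N van t =
        spread r₀ 1 t (proj₁ (representative r₀ r₀≤Q)) (proj₂ (representative r₀ r₀≤Q)) vanishes-at-1
        where
        δ+c≡d : δ + c ≡ d
        δ+c≡d = ℕ.suc-injective δ+c≡

        c≤d : c ≤ d
        c≤d = subst (c ≤_) δ+c≡d (ℕ.m≤n+m c δ)

        open Propagation d N c δ d<q δ+c≡d f df n+2c≡N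

        -- The exchange difference inherits vanishing on `E`, since both of its terms add one to the
        -- weight, as does passing from `c` to `suc c`.
        swap-invariant : ∀ {u v : Vec Bool n} → u ∼ v → weight u + c ≡ 1 * q + r₀ → f u ≋ f v
        swap-invariant (swap {m} i z) w+c≡ = mod (vanishes-on-class δ (suc c) (exchange i f)
          (Degree<-exchange δ i f df) (trans (ℕ.+-suc δ c) δ+c≡) (trans (regroup m c) n+2c≡N)
          (λ k k∈E z′ w′ → ℤ∣.∣m∣n⇒∣m-n
            (van k k∈E _ (trans (weight₁ true false z′ refl) w′))
            (van k k∈E _ (trans (weight₁ false true z′ refl) w′)))
          1 z (trans (sym (weight₁ true false z refl)) w+c≡))
          where
          regroup : ∀ m c → m + (suc c + suc c) ≡ suc (suc m) + (c + c)
          regroup = ℕSolver.solve-∀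
          weight₁ : ∀ a b z → bit a + bit b ≡ 1 → weight (insert₂ a b i z) + c ≡ weight z + suc c
          weight₁ a b z a+b≡1 = trans
            (cong (_+ c) (trans (weight-insert₂ a b i z) (cong (_+ weight z) a+b≡1)))
            (sym (ℕ.+-suc (weight z) c))

        -- With `q ∸ c` fixed ones, slice `r` of the subcube has weight `q + r` in the original
        -- cube.
        b : ℕ
        b = q ∸ c

        b+c≡q : b + c ≡ q
        b+c≡q = ℕ.m∸n+n≡m (ℕ.≤-trans c≤d (ℕ.<⇒≤ d<q))

        Q+b≤n : Q + b ≤ n
        Q+b≤n = ℕ.+-cancelʳ-≤ (c + c) (Q + b) n (begin
          Q + b + (c + c)  ≡⟨ regroup Q b c ⟩
          (b + c) + Q + c  ≡⟨ cong (λ v → v + Q + c) b+c≡q ⟩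
          q + Q + c        ≤⟨ ℕ.+-monoʳ-≤ (q + Q) c≤d ⟩
          q + Q + d        ≤⟨ large ⟩
          N                ≡⟨ n+2c≡N ⟨
          n + (c + c)      ∎)
          where
          open ℕ.≤-Reasoning
          regroup : ∀ Q b c → Q + b + (c + c) ≡ (b + c) + Q + c
          regroup = ℕSolver.solve-∀

        s : Subcube Q n
        s = proj₁ (subcubeWith n Q b Q+b≤n)

        weight-s : ∀ z {r} → weight z ≡ r → weight (point s z) + c ≡ 1 * q + r
        weight-s z {r} wz = begin
          weight (point s z) + c      ≡⟨ cong (_+ c) (weight-point s z) ⟩
          fixedOnes s + weight z + c  ≡⟨ cong₂ (λ u v → u + v + c) (proj₂ (subcubeWith n Q b Q+b≤n)) wz ⟩
          b + r + c                   ≡⟨ regroup b r c ⟩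
          1 * (b + c) + r             ≡⟨ cong (λ v → 1 * v + r) b+c≡q ⟩
          1 * q + r                   ∎
          where
          open ≡-Reasoning
          regroup : ∀ b r c → b + r + c ≡ 1 * (b + c) + r
          regroup = ℕSolver.solve-∀

        g : CubeFun Q
        g = f ∘ point s

        -- The degree bound is relaxed from `δ` to `d`, the degree that `closed` speaks about.
        averaged : Σ (ℕ → ℤ) λ a → ∀ r → r ≤ Q → sliceSum r g ≋ sgn r ℤ.* binomialSum (suc d) a r
        averaged = sliceSum≋binomialSum (suc d) d<q g (Degree<-point (suc d) s
          (Degree<-mono (s≤s (subst (δ ≤_) δ+c≡d (ℕ.m≤m+n δ c))) df))

        a : ℕ → ℤ
        a = proj₁ averaged

        -- Vanishing moves from weight `k` to the representative of its class, where the sum over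
        -- slice `r` of the subcube shows that the binomial sum vanishes at `r`; periodicity returns
        -- to `k`.
        a-vanishes : ∀ k → E k → + p ℤ∣.∣ binomialSum (suc d) a k
        a-vanishes k k∈E = subst (λ v → + p ℤ∣.∣ binomialSum (suc d) a v) (sym k≡)
          (∣-resp-≋ (≋-sym (binomialSum-periodic (suc d) d<q a (k / q) r))
            (∣sgn*⇒∣ r (∣-resp-≋ (proj₂ averaged r r≤Q)
              (∣-sliceSum r (λ z wz → vanishes-at-rep (point s z) (weight-s z wz))))))
          where
          r : ℕ
          r = k % q
          r≤Q : r ≤ Q
          r≤Q = ℕ.≤-pred (ℕ.m%n<n k q)
          k≡ : k ≡ k / q * q + r
          k≡ = trans (ℕ.m≡m%n+[m/n]*n k q) (ℕ.+-comm r (k / q * q))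
          vanishes-at-rep : Vanishes c f (1 * q + r)
          vanishes-at-rep = spread r (k / q) 1
            (subst (d ≤_) k≡ (proj₁ (E-range k k∈E)))
            (subst (λ v → v + d ≤ N) k≡ (proj₂ (E-range k k∈E)))
            (subst (Vanishes c f) k≡ (van k k∈E))

        -- By `closed` the sum over slice `r₀` vanishes. Since `f` is constant there, this sum is
        -- `f x` times `Q C r₀`, a sign modulo `p`.
        vanishes-at-1 : Vanishes c f (1 * q + r₀)
        vanishes-at-1 x wx = ∣sgn*⇒∣ r₀ (∣-resp-≋ sum≋ (∣-resp-≋ (≋-sym (proj₂ averaged r₀ r₀≤Q))
          (ℤ∣.∣n⇒∣m*n (sgn r₀) (closed a a-vanishes))))
          where
          open ≋-Reasoning
          constant : ∀ z → weight z ≡ r₀ → g z ≋ f x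
          constant z wz = slice-constant (weight x) f
            (λ u∼v wu → swap-invariant u∼v (trans (cong (_+ c) wu) wx)) (point s z) x
            (ℕ.+-cancelʳ-≡ c _ _ (trans (weight-s z wz) (sym wx))) refl
          sum≋ : sliceSum r₀ g ≋ sgn r₀ ℤ.* f x
          sum≋ = begin
            sliceSum r₀ g                  ≈⟨ sliceSum-cong-≋ r₀ constant ⟩
            sliceSum {Q} r₀ (λ _ → f x)    ≡⟨ sliceSum-const Q r₀ (f x) ⟩
            f x ℤ.* + (Q C r₀)             ≈⟨ *-congˡ-≋ (f x) (QCi≋sgn r₀ r₀≤Q) ⟩
            f x ℤ.* sgn r₀                 ≡⟨ ℤ.*-comm (f x) (sgn r₀) ⟩
            sgn r₀ ℤ.* f x                 ∎

-- Polynomials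

-- On the cube a positive power of a variable equals the variable. So `Δ` gives the remaining
-- monomial for a positive first exponent, and zero for exponent zero.
evalMonℤ-degree : (μ : Monomial n) → Degree< (suc (totalDegree μ)) (λ x → + evalMon x μ)
evalMonℤ-degree [] = tt
evalMonℤ-degree (zero ∷ μ) =
  Degree<-cong _ (λ x → cong +_ (sym (ℕ.*-identityˡ (evalMon x μ)))) (evalMonℤ-degree μ) ,
  Degree<-zero _ (λ x → ℤ.+-inverseʳ (+ (1 * evalMon x μ)))
evalMonℤ-degree (suc k ∷ μ) =
  Degree<-zero _ (λ x → refl) ,
  Degree<-cong _ (λ x → sym (trans (ℤ.+-identityʳ _) (cong +_ (trans (cong (_* evalMon x μ) (ℕ.^-zeroˡ (suc k))) (ℕ.*-identityˡ _)))))
    (Degree<-mono (s≤s (ℕ.m≤n+m (totalDegree μ) k)) (evalMonℤ-degree μ))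

evalℤ-degree : ∀ d (P : Poly n) → DegLe d P → Degree< (suc d) (λ x → + eval P x)
evalℤ-degree d [] [] = Degree<-zero _ (λ _ → refl)
evalℤ-degree d ((c , μ) ∷ P) (le ∷ deg) =
  Degree<-cong (suc d) (λ x → cong₂ ℤ._+_ (sym (ℤ.pos-* c (evalMon x μ))) (ℤ.*-identityˡ _))
    (Degree<-comb (suc d) (+ c) 1ℤ (Degree<-mono (s≤s le) (evalMonℤ-degree μ)) (evalℤ-degree d P deg))

-- Symmetric polynomials with given coefficients

prefix : ℕ → Poly n → Poly (suc n)
prefix k = map (λ (c , μ) → c , k ∷ μ)

-- The sum of a |S| · X^S over the sets S of fewer than e variables.
symmetricPoly : ∀ n → ℕ → (ℕ → ℕ) → Poly n
symmetricPoly n       zero    a = []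
symmetricPoly zero    (suc e) a = (a 0 , []) ∷ []
symmetricPoly (suc n) (suc e) a = prefix 0 (symmetricPoly n (suc e) a) ++ prefix 1 (symmetricPoly n e (a ∘ suc))

eval-++ : ∀ (P R : Poly n) x → eval (P ++ R) x ≡ eval P x + eval R x
eval-++ []            R x = refl
eval-++ ((c , μ) ∷ P) R x = trans (cong (λ v → c * evalMon x μ + v) (eval-++ P R x))
  (sym (ℕ.+-assoc (c * evalMon x μ) (eval P x) (eval R x)))

eval-prefix : ∀ k (P : Poly n) b x → eval (prefix k P) (b ∷ x) ≡ bit b ^ k * eval P x
eval-prefix k []            b x = sym (ℕ.*-zeroʳ (bit b ^ k))
eval-prefix k ((c , μ) ∷ P) b x = trans (cong (λ v → c * (bit b ^ k * evalMon x μ) + v) (eval-prefix k P b x))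
  (regroup c (bit b ^ k) (evalMon x μ) (eval P x))
  where
  regroup : ∀ c k μ v → c * (k * μ) + k * v ≡ k * (c * μ + v)
  regroup = ℕSolver.solve-∀

-- Pascal's rule termwise; it mirrors the recursion of `symmetricPoly` when the first coordinate is
-- 1.
binomialSum-suc : ∀ e a k → binomialSum (suc e) a (suc k) ≡ binomialSum (suc e) a k ℤ.+ binomialSum e (a ∘ suc) k
binomialSum-suc e a k = begin
  a 0 ℤ.* + (suc k C 0) ℤ.+ ∑ e (λ j → a (suc j) ℤ.* + (suc k C suc j))
    ≡⟨ cong₂ ℤ._+_ (cong (λ c → a 0 ℤ.* + c) (trans (nC0≡1 (suc k)) (sym (nC0≡1 k)))) (∑-cong e term) ⟩
  a 0 ℤ.* + (k C 0) ℤ.+ ∑ e (λ j → a (suc j) ℤ.* + (k C suc j) ℤ.+ a (suc j) ℤ.* + (k C j))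
    ≡⟨ cong (λ v → a 0 ℤ.* + (k C 0) ℤ.+ v) (∑-+ e _ _) ⟩
  a 0 ℤ.* + (k C 0) ℤ.+ (∑ e (λ j → a (suc j) ℤ.* + (k C suc j)) ℤ.+ binomialSum e (a ∘ suc) k)
    ≡⟨ ℤ.+-assoc (a 0 ℤ.* + (k C 0)) _ _ ⟨
  binomialSum (suc e) a k ℤ.+ binomialSum e (a ∘ suc) k ∎
  where
  open ≡-Reasoning
  term : ∀ j → a (suc j) ℤ.* + (suc k C suc j) ≡ a (suc j) ℤ.* + (k C suc j) ℤ.+ a (suc j) ℤ.* + (k C j)
  term j = trans (cong (λ c → a (suc j) ℤ.* + c) (trans (pascal k j) (ℕ.+-comm (k C j) _)))
                 (ℤ.*-distribˡ-+ (a (suc j)) _ _)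

eval-symmetricPoly : ∀ n e a (x : Vec Bool n) → + eval (symmetricPoly n e a) x ≡ binomialSum e (+_ ∘ a) (weight x)
eval-symmetricPoly n zero a x = refl
eval-symmetricPoly zero (suc e) a [] = cong₂ ℤ._+_ (ℤ.pos-* (a 0) 1)
  (sym (∑-zero e (λ j → trans (cong (λ c → + a (suc j) ℤ.* + c) (k>n⇒nCk≡0 {0} {suc j} (s≤s z≤n))) (ℤ.*-zeroʳ (+ a (suc j))))))
eval-symmetricPoly (suc n) (suc e) a (b ∷ x) = trans (cong +_ split) (byFirst b)
  where
  P R : Poly n
  P = symmetricPoly n (suc e) a
  R = symmetricPoly n e (a ∘ suc)
  split : eval (symmetricPoly (suc n) (suc e) a) (b ∷ x) ≡ bit b ^ 0 * eval P x + bit b ^ 1 * eval R x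
  split = trans (eval-++ (prefix 0 P) (prefix 1 R) (b ∷ x)) (cong₂ _+_ (eval-prefix 0 P b x) (eval-prefix 1 R b x))
  byFirst : ∀ b → + (bit b ^ 0 * eval P x + bit b ^ 1 * eval R x) ≡ binomialSum (suc e) (+_ ∘ a) (weight (b ∷ x))
  byFirst false = trans (cong +_ (trans (ℕ.+-identityʳ _) (ℕ.*-identityˡ _))) (eval-symmetricPoly n (suc e) a x)
  byFirst true  = trans (cong +_ (cong₂ _+_ (ℕ.*-identityˡ (eval P x)) (ℕ.*-identityˡ (eval R x))))
    (trans (cong₂ ℤ._+_ (eval-symmetricPoly n (suc e) a x) (eval-symmetricPoly n e (a ∘ suc) x))
           (sym (binomialSum-suc e (+_ ∘ a) (weight x))))

symmetricPoly-degree : ∀ n e a → All (λ t → totalDegree (proj₂ t) < e) (symmetricPoly n e a)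
symmetricPoly-degree n       zero    a = []
symmetricPoly-degree zero    (suc e) a = s≤s z≤n ∷ []
symmetricPoly-degree (suc n) (suc e) a =
  ++⁺ (map⁺ (symmetricPoly-degree n (suc e) a)) (map⁺ (All.map s≤s (symmetricPoly-degree n e (a ∘ suc))))

coeff-++ : ∀ (P R : Poly n) μ → coeff (P ++ R) μ ≡ coeff P μ + coeff R μ
coeff-++ []            R μ = refl
coeff-++ ((c , ν) ∷ P) R μ = trans (cong (λ v → (if does (≡-dec ℕ._≟_ ν μ) then c else 0) + v) (coeff-++ P R μ))
  (sym (ℕ.+-assoc (if does (≡-dec ℕ._≟_ ν μ) then c else 0) (coeff P μ) (coeff R μ)))

coeff-prefix : ∀ k l (P : Poly n) μ → coeff (prefix k P) (l ∷ μ) ≡ (if k ≡ᵇ l then coeff P μ else 0)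
coeff-prefix k l [] μ with k ≡ᵇ l
... | true  = refl
... | false = refl
coeff-prefix k l ((c , ν) ∷ P) μ with k ≡ᵇ l | coeff-prefix k l P μ
... | true  | ih = cong (λ v → (if does (≡-dec ℕ._≟_ ν μ) then c else 0) + v) ih
... | false | ih = ih

Flat : Monomial n → Set
Flat μ = ∀ i → lookup μ i ≤ 1

-- The coefficient in `symmetricPoly` of a squarefree monomial of degree `t`.
truncated : ℕ → (ℕ → ℕ) → ℕ → ℕ
truncated zero    a t       = 0
truncated (suc e) a zero    = a 0
truncated (suc e) a (suc t) = truncated e (a ∘ suc) t

coeff-flat : ∀ n e a (μ : Monomial n) → Flat μ → coeff (symmetricPoly n e a) μ ≡ truncated e a (totalDegree μ)
coeff-flat n zero a μ flat = refl
coeff-flat zero (suc e) a [] flat = ℕ.+-identityʳ (a 0)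
coeff-flat (suc n) (suc e) a (k ∷ μ) flat =
  trans (coeff-++ (prefix 0 P) (prefix 1 R) (k ∷ μ))
    (trans (cong₂ _+_ (coeff-prefix 0 k P μ) (coeff-prefix 1 k R μ)) (byFirst k (flat zero)))
  where
  P R : Poly n
  P = symmetricPoly n (suc e) a
  R = symmetricPoly n e (a ∘ suc)
  byFirst : ∀ k → k ≤ 1 → (if 0 ≡ᵇ k then coeff P μ else 0) + (if 1 ≡ᵇ k then coeff R μ else 0) ≡
            truncated (suc e) a (k + totalDegree μ)
  byFirst zero       _ = trans (ℕ.+-identityʳ _) (coeff-flat n (suc e) a μ (flat ∘ suc))
  byFirst (suc zero) _ = coeff-flat n e (a ∘ suc) μ (flat ∘ suc)
  byFirst (suc (suc k)) (s≤s ())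

coeff-nonflat : ∀ n e a (μ : Monomial n) → ¬ Flat μ → coeff (symmetricPoly n e a) μ ≡ 0
coeff-nonflat n zero a μ _ = refl
coeff-nonflat zero (suc e) a [] ¬flat = ⊥-elim (¬flat λ ())
coeff-nonflat (suc n) (suc e) a (k ∷ μ) ¬flat =
  trans (coeff-++ (prefix 0 P) (prefix 1 R) (k ∷ μ))
    (trans (cong₂ _+_ (coeff-prefix 0 k P μ) (coeff-prefix 1 k R μ)) (byFirst k ¬flat))
  where
  P R : Poly n
  P = symmetricPoly n (suc e) a
  R = symmetricPoly n e (a ∘ suc)
  tail : ∀ {k} → k ≤ 1 → ¬ Flat (k ∷ μ) → ¬ Flat μ
  tail k≤1 ¬flat flat = ¬flat λ { zero → k≤1 ; (suc i) → flat i }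
  byFirst : ∀ k → ¬ Flat (k ∷ μ) → (if 0 ≡ᵇ k then coeff P μ else 0) + (if 1 ≡ᵇ k then coeff R μ else 0) ≡ 0
  byFirst zero          ¬flat = trans (ℕ.+-identityʳ _) (coeff-nonflat n (suc e) a μ (tail z≤n ¬flat))
  byFirst (suc zero)    ¬flat = coeff-nonflat n e (a ∘ suc) μ (tail (s≤s z≤n) ¬flat)
  byFirst (suc (suc k)) ¬flat = refl

totalDegree-lookup : (μ : Monomial n) → totalDegree μ ≡ sum (lookup μ)
totalDegree-lookup []      = refl
totalDegree-lookup (k ∷ μ) = cong (λ v → k + v) (totalDegree-lookup μ)

totalDegree-tabulate : (h : Fin n → ℕ) → totalDegree (tabulate h) ≡ sum h
totalDegree-tabulate {zero}  h = refl
totalDegree-tabulate {suc n} h = cong (λ v → h zero + v) (totalDegree-tabulate (h ∘ suc))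

totalDegree-permMon : (σ : Permutation′ n) (μ : Monomial n) → totalDegree (permMon σ μ) ≡ totalDegree μ
totalDegree-permMon σ μ = trans (totalDegree-tabulate (λ i → lookup μ (σ ⟨$⟩ʳ i)))
  (trans (sym (sum-permute (lookup μ) σ)) (sym (totalDegree-lookup μ)))

flat-permMon : (σ : Permutation′ n) (μ : Monomial n) → Flat μ → Flat (permMon σ μ)
flat-permMon σ μ flat i = subst (_≤ 1) (sym (lookup∘tabulate _ i)) (flat (σ ⟨$⟩ʳ i))

flat-permMon⁻¹ : (σ : Permutation′ n) (μ : Monomial n) → Flat (permMon σ μ) → Flat μ
flat-permMon⁻¹ σ μ flat i = subst (_≤ 1)
  (trans (lookup∘tabulate _ (σ ⟨$⟩ˡ i)) (cong (lookup μ) (inverseʳ σ))) (flat (σ ⟨$⟩ˡ i))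

-- A coefficient depends only on squarefreeness and total degree, which permutations preserve; the
-- coefficients agree even as natural numbers.
symmetricPoly-symmetric : ∀ p n e a → Symmetric p (symmetricPoly n e a)
symmetricPoly-symmetric p n e a σ μ = subst (p ℕ∣.∣_) (sym (ℕ.m≡n⇒∣m-n∣≡0 same)) (p ℕ∣.∣0)
  where
  same : coeff (symmetricPoly n e a) (permMon σ μ) ≡ coeff (symmetricPoly n e a) μ
  same with all? (λ i → lookup μ i ℕ.≤? 1)
  ... | yes flat = trans (coeff-flat n e a (permMon σ μ) (flat-permMon σ μ flat))
    (trans (cong (truncated e a) (totalDegree-permMon σ μ)) (sym (coeff-flat n e a μ flat)))
  ... | no ¬flat = trans (coeff-nonflat n e a (permMon σ μ) (¬flat ∘ flat-permMon⁻¹ σ μ))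
    (sym (coeff-nonflat n e a μ ¬flat))

-- Modulo `p`, the binomial sum is the evaluation of a symmetric polynomial of degree at most `d`,
-- against which the closure can be tested.
symcl-binomialSum : ∀ p .{{_ : NonZero p}} d {E} (y : Vec Bool n) → InSymcl p n d E y → ∀ a →
  (∀ k → E k → + p ℤ∣.∣ binomialSum (suc d) a k) → + p ℤ∣.∣ binomialSum (suc d) a (weight y)
symcl-binomialSum {n} p d {E} y y∈cl a vanishes =
  ∣-resp-≋ (eval≋ y) (ℤ∣.∣ᵤ⇒∣ (y∈cl P (All.map ℕ.≤-pred (symmetricPoly-degree n (suc d) a′))
    (symmetricPoly-symmetric p n (suc d) a′)
    λ x x∈E → ℤ∣.∣⇒∣ᵤ (∣-resp-≋ (≋-sym (eval≋ x)) (vanishes (weight x) x∈E))))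
  where
  open Congruence p
  -- Polynomials carry natural coefficients, so the integers `a j` are replaced by their residues.
  a′ : ℕ → ℕ
  a′ j = a j %ℕ p
  P : Poly n
  P = symmetricPoly n (suc d) a′
  a′≋a : ∀ j → + a′ j ≋ a j
  a′≋a j = ≋-sym (mod (ℤ∣.divides (a j /ℕ p) (trans (cong (ℤ._- + a′ j) (a≡a%ℕn+[a/ℕn]*n (a j) p)) (cancel (+ a′ j) _))))
    where
    cancel : ∀ u v → (u ℤ.+ v) ℤ.- u ≡ v
    cancel = ℤSolver.solve-∀
  eval≋ : ∀ x → + eval P x ≋ binomialSum (suc d) a (weight x)
  eval≋ x = ≋-trans (≋-reflexive (eval-symmetricPoly n (suc d) a′ x))
    (∑-cong-≋ (suc d) (λ j _ → *-congʳ-≋ (+ (weight x C j)) (a′≋a j)))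

-- Equality of the two closures

theorem1p6 : (p d ℓ n : ℕ) → Prime p → IsCeilLog p d ℓ → 4 * p ^ ℓ ≤ n + 1 →
    (E : ℕ → Set) → ((k : ℕ) → E k → (d ≤ k) × (k ≤ n ∸ d)) →
    (y : Vec Bool n) → InZcl p n d E y ⇔ InSymcl p n d E y
theorem1p6 p d ℓ n p-prime (d<pˡ , _) 4pˡ≤n+1 E E-range y = mk⇔
  (λ y∈Zcl P deg _ → y∈Zcl P deg)
  (λ y∈Symcl P deg van → symcl⇒zcl (p ^ ℓ) refl d<pˡ 4pˡ≤n+1 y∈Symcl P deg van)
  where
  open Congruence p
  -- A variable `q` in place of `p ^ ℓ` can be matched as `suc Q`; `d < q` rules out zero.
  symcl⇒zcl : ∀ q → q ≡ p ^ ℓ → d < q → 4 * q ≤ n + 1 → InSymcl p n d E y → InZcl p n d E y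
  symcl⇒zcl (suc Q) q≡pˡ d<q 4q≤n+1 y∈Symcl P deg van =
    ℤ∣.∣⇒∣ᵤ (vanishes-on-class (suc d) 0 (λ x → + eval P x) (evalℤ-degree d P deg)
      (ℕ.+-identityʳ (suc d)) (ℕ.+-identityʳ n)
      (λ k k∈E x w≡k → ℤ∣.∣ᵤ⇒∣ (van x (subst E (trans (sym w≡k) (ℕ.+-identityʳ (weight x))) k∈E)))
      t y (trans (ℕ.+-identityʳ (weight y)) w≡))
    where
    instance
      p-nonZero : NonZero p
      p-nonZero = prime⇒nonZero p-prime
    open Period Q (λ i i<q → ℤ∣.∣ᵤ⇒∣ (subst (λ q → p ℕ∣.∣ q C suc i) (sym q≡pˡ)
      (prime∣primePowerCk p-prime ℓ i (subst (suc i <_) q≡pˡ i<q))))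
    r t : ℕ
    r = weight y % q
    t = weight y / q
    w≡ : weight y ≡ t * q + r
    w≡ = trans (ℕ.m≡m%n+[m/n]*n (weight y) q) (ℕ.+-comm r (t * q))
    large : q + Q + d ≤ n
    large = ℕ.≤-pred (begin
      suc (q + Q + d)        ≡⟨ cong (_+ d) (ℕ.+-suc q Q) ⟨
      q + q + d              ≤⟨ ℕ.+-monoʳ-≤ (q + q) (ℕ.<⇒≤ d<q) ⟩
      q + q + q              ≤⟨ ℕ.m≤m+n (q + q + q) q ⟩
      q + q + q + q          ≡⟨ regroup q ⟩
      4 * q                  ≤⟨ 4q≤n+1 ⟩
      n + 1                  ≡⟨ ℕ.+-comm n 1 ⟩
      suc n                  ∎)
      where
      open ℕ.≤-Reasoning
      regroup : ∀ q → q + q + q + q ≡ 4 * q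
      regroup = ℕSolver.solve-∀
    open Closure d n d<q large E
      (λ k k∈E → proj₁ (E-range k k∈E) ,
        -- Truncated subtraction makes `d ≤ n` necessary here; it follows from `large`.
        ℕ.m≤o∸n⇒m+n≤o k (ℕ.≤-trans (ℕ.m≤n+m d (q + Q)) large) (proj₂ (E-range k k∈E)))
      r (ℕ.≤-pred (ℕ.m%n<n (weight y) q))
      -- The closure property of `weight y` passes to its residue `r` by periodicity.
      (λ a vanishes → ∣-resp-≋
        (≋-trans (≋-reflexive (cong (binomialSum (suc d) a) w≡)) (binomialSum-periodic (suc d) d<q a t r))
        (symcl-binomialSum p d y y∈Symcl a vanishes))
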